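{- Let $q=p^h$, $p$ prime, $h\ge1$, and $n/2\le k\le n-1$. If $v$ is the incidence vector of a small linear $k$-blocking set of $PG(n,q)$ that is non-trivial (contains no $k$-dimensional subspace), then $v\notin C_k(n,q)$.
   Context: $C_k(n,q)$ is the $p$-ary linear code spanned over $\mathbb{F}_p$ by the rows of the incidence matrix of $k$-dimensional subspaces versus points of $PG(n,q)$ (entry $1$ iff the point lies in the subspace). Field reduction: points of $PG(n,p^h)$ correspond to the elements of the Desarguesian $(h-1)$-spread $\mathcal{D}$ of $PG(h(n+1)-1,p)$ obtained by viewing $1$-dimensional $\mathbb{F}_{p^h}$-subspaces of $\mathbb{F}_{p^h}^{n+1}$ as $h$-dimensional $\mathbb{F}_p$-subspaces of $\mathbb{F}_p^{h(n+1)}$. For $U\subseteq PG(h(n+1)-1,p)$, $\mathcal{B}(U)$ is the set of points of $PG(n,p^h)$ whose spread elements meet $U$. A small linear $k$-blocking set is a set $\mathcal{B}(U)$ with $U$ an $hk$-dimensional projective subspace of $PG(h(n+1)-1,p)$; it meets every $(n-k)$-dimensional subspace of $PG(n,q)$. -}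

module Defs where

open import Level using (0ℓ)
open import Algebra.Bundles using (CommutativeRing)
open import Data.Nat using (ℕ; zero; suc)
import Data.Nat as N
open import Data.Fin using (Fin; zero; suc; toℕ)
open import Data.Product using (Σ; _×_; _,_)
open import Relation.Nullary using (¬_)
open import Relation.Binary.PropositionalEquality using (_≡_)

∑ℕ : ∀ m → (Fin m → ℕ) → ℕ
∑ℕ zero    f = 0
∑ℕ (suc m) f = f zero N.+ ∑ℕ m (λ i → f (suc i))

_≡[mod_]_ : ℕ → ℕ → ℕ → Set
a ≡[mod p ] b = Σ ℕ λ s → Σ ℕ λ t → a N.+ s N.* p ≡ b N.+ t N.* p

module _ (R : CommutativeRing 0ℓ 0ℓ) where
  open CommutativeRing R using (Carrier; _≈_; _+_; _*_; 0#; 1#)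

  record IsField : Set where
    field
      1≉0     : ¬ (1# ≈ 0#)
      inverse : ∀ x → ¬ (x ≈ 0#) → Σ Carrier λ y → x * y ≈ 1#

  HasSize : ℕ → Set
  HasSize N = Σ (Fin N → Carrier) λ e →
    (∀ i j → e i ≈ e j → i ≡ j) × (∀ x → Σ (Fin N) λ i → e i ≈ x)

  ∑F : ∀ m → (Fin m → Carrier) → Carrier
  ∑F zero    f = 0#
  ∑F (suc m) f = f zero + ∑F m (λ i → f (suc i))

  -- c · x for c ∈ ℕ (repeated addition); for c < p this is the F_p-scalar action
  natMul : ℕ → Carrier → Carrier
  natMul zero    x = 0#
  natMul (suc c) x = x + natMul c x

  -- homogeneous coordinate vectors of PG(n,q): elements of F^(n+1)
  Vector : ℕ → Set
  Vector n = Fin (suc n) → Carrier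

  _≈v_ : ∀ {n} → Vector n → Vector n → Set
  x ≈v y = ∀ j → x j ≈ y j

  0v : ∀ {n} → Vector n
  0v j = 0#

  NonZeroV : ∀ {n} → Vector n → Set
  NonZeroV x = ¬ (x ≈v 0v)

  smul : ∀ {n} → Carrier → Vector n → Vector n
  smul a x j = a * x j

  linComb : ∀ {m n} → (Fin m → Carrier) → (Fin m → Vector n) → Vector n
  linComb {m} a b j = ∑F m (λ i → a i * b i j)

  -- a projective k-dimensional subspace of PG(n,q), given by an F-basis of
  -- k+1 linearly independent vectors of F^(n+1)
  record Subspace (k n : ℕ) : Set where
    field
      basis       : Fin (suc k) → Vector n
      independent : ∀ a → linComb a basis ≈v 0v → ∀ i → a i ≈ 0#

  InSub : ∀ {k n} → Subspace k n → Vector n → Set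
  InSub {k} S x = Σ (Fin (suc k) → Carrier) λ a → x ≈v linComb a (Subspace.basis S)

  fpComb : ∀ {m n} p → (Fin m → Fin p) → (Fin m → Vector n) → Vector n
  fpComb {m} p c u j = ∑F m (λ i → natMul (toℕ (c i)) (u i j))

  -- field reduction: F^(n+1) viewed as F_p^(h(n+1)).
  -- A projective d-dimensional subspace of PG(h(n+1)-1,p), given by an
  -- F_p-basis of d+1 F_p-linearly independent vectors.
  record FpSubspace (p d n : ℕ) : Set where
    field
      basis       : Fin (suc d) → Vector n
      independent : ∀ (c : Fin (suc d) → Fin p) →
                    fpComb p c basis ≈v 0v → ∀ i → toℕ (c i) ≡ 0

  InFp : ∀ {p d n} → FpSubspace p d n → Vector n → Set
  InFp {p} {d} U x = Σ (Fin (suc d) → Fin p) λ c → x ≈v fpComb p c (FpSubspace.basis U)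

  -- B(U): the point ⟨x⟩ of PG(n,q) belongs to B(U) iff its spread element
  -- {λx : λ ∈ F} meets U in a nonzero vector
  InB : ∀ {p d n} → FpSubspace p d n → Vector n → Set
  InB U x = Σ Carrier λ l → ¬ (l ≈ 0#) × InFp U (smul l x)

  -- f (a function on coordinate vectors, read on nonzero ones, i.e. on points)
  -- is the incidence vector (over F_p, values 0/1) of the point set P
  IsIncidenceVector : ∀ n → (Vector n → Set) → (Vector n → ℕ) → Set
  IsIncidenceVector n P f =
    ∀ x → NonZeroV x → (P x → f x ≡ 1) × (¬ P x → f x ≡ 0)

  -- v ∈ C_k(n,q): v is an F_p-linear combination of incidence vectors of
  -- k-dimensional subspaces of PG(n,q) (values compared modulo p)
  InCode : ∀ (p k n : ℕ) → (Vector n → ℕ) → Set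
  InCode p k n v =
    Σ ℕ λ m →
    Σ (Fin m → Subspace k n) λ S →
    Σ (Fin m → Vector n → ℕ) λ χ →
    (∀ i → IsIncidenceVector n (InSub (S i)) (χ i)) ×
    Σ (Fin m → ℕ) λ a →
      ∀ x → NonZeroV x → v x ≡[mod p ] ∑ℕ m (λ i → a i N.* χ i x)

  ContainsSubspace : ∀ {p d} k n → FpSubspace p d n → Set
  ContainsSubspace k n U =
    Σ (Subspace k n) λ S → ∀ x → NonZeroV x → InSub S x → InB U x

{-# OPTIONS --safe #-}

-- Write q = pʰ; for h = 1 the set B(U) = U is itself a k-space, so let h ≥ 2.
-- Counting gives an F-subspace A of F^(n+1) of dimension n − k that misses U. The
-- first moment Σ_{y ∈ A} y f(v + y) of a k-space f is an F-linear function of v: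
-- it reads off the intersection of v + A with the k-space when that is a
-- complement of A, and vanishes otherwise, because q = 0 and Σ_{c ∈ F} c = 0 in F.
-- Hence a codeword f has an F-linear first moment ℓ, and a constant zeroth
-- moment. Let f be the incidence vector of B(U). If the coset u + A meets B(U)
-- only in ⟨u⟩, then ℓ(u) = 0. Such tangent vectors u are not contained in any
-- 𝔽ₚ-hyperplane U₁ of U: otherwise every point of U would be equivalent modulo A
-- to a point of U₁, and U₁, which has only p^(hk) vectors, would cover all of
-- PG(V/A). So ℓ vanishes on U, which places U in the (k+1)-dimensional kernel of
-- ℓ, and then B(U) contains a k-space.
module Submission where

open import Defs
open import Level using (0ℓ)
open import Algebra.Bundles using (CommutativeRing)
open import Algebra.Solver.Ring.AlmostCommutativeRing using (fromCommutativeRing; _-Raw-AlmostCommutative⟶_)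
import Algebra.Properties.AbelianGroup
import Algebra.Properties.Ring
import Algebra.Properties.Semiring.Mult.TCOptimised
import Algebra.Properties.Semiring.Sum
import Algebra.Solver.Ring
open import Data.Empty using (⊥; ⊥-elim)
open import Data.Fin using (Fin; zero; suc; toℕ; fromℕ<; combine; remQuot; funToFin; finToFun)
import Data.Fin.Permutation as Perm
import Data.Fin.Properties as Finₚ
open import Data.Integer as ℤ using (ℤ; +_; -[1+_]; _⊖_; _◃_)
import Data.Integer.Properties as ℤₚ
open import Data.List using (List; []; _∷_)
open import Data.Maybe using (Maybe; just; nothing)
open import Data.Nat as ℕ using (ℕ; zero; suc)
open import Data.Nat.Coprimality using (prime⇒coprime; coprime-Bézout)
open import Data.Nat.DivMod using (_%_; _/_; m≡m%n+[m/n]*n; m%n<n)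
open import Data.Nat.GCD using (module Bézout)
open import Data.Nat.Primality using (Prime; prime⇒nonZero; prime⇒nonTrivial)
import Data.Nat.Properties as ℕₚ
open import Data.Nat.Solver using (module +-*-Solver)
open import Data.Product using (Σ; ∃; ∃₂; _×_; _,_; proj₁; proj₂)
open import Data.Product.Relation.Binary.Pointwise.NonDependent using (_×ₛ_)
import Data.Sign as Sign
open import Data.Sum using (inj₁; inj₂)
open import Data.Vec.Functional using () renaming (_∷_ to _∷ᵥ_)
open import Data.Vec.Functional.Relation.Binary.Equality.Setoid using (≋-setoid)
open import Function using (_∘_)
open import Relation.Binary using (tri<; tri≈; tri>)
open import Relation.Binary.Bundles using (Setoid)
open import Relation.Binary.PropositionalEquality as ≡ using (_≡_)
import Relation.Binary.Reasoning.Setoid as SetoidReasoning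
open import Relation.Nullary using (¬_; Dec; yes; no)
open import Relation.Nullary.Decidable using (map′; decidable-stable; ¬?; _×-dec_)

-- The zeroth moment is needed beside the first because translation by A changes the first: ℓ(v + y)
-- = ℓ(v) - mass · y for y in A. A single tangent coset gives mass = 1, so ℓ is injective on A and
-- its kernel is a complement of A. As V = F U + A, a kernel vector l u + y must have y = 0 once ℓ
-- vanishes on U, and so it is an F-multiple of a vector of U.
--
-- All counting compares F × U × A with V, the former having exactly p times as many elements. The
-- surplus factor p forces every coset of A to meet F U. For an 𝔽ₚ-hyperplane U₁ of U the two sides
-- have equal size, so a map from F × U₁ × A onto V would be bijective, although all triples (l, 0,
-- y) with the same y have the same image.
--
-- The assumption h ≥ 2 acts twice: it keeps F U + A small enough for A to be enlarged up to
-- dimension n - k, and it supplies a μ other than 0 and 1, for which μ ∑ c = ∑ c forces ∑ c = 0.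

-- Finite setoids: exhaustive search and pigeonhole principles.

record Finite (S : Setoid 0ℓ 0ℓ) (N : ℕ) : Set where
  open Setoid S using (Carrier; _≈_)
  field
    index         : Carrier → Fin N
    element       : Fin N → Carrier
    index-cong    : ∀ {x y} → x ≈ y → index x ≡ index y
    index-element : ∀ i → index (element i) ≡ i
    element-index : ∀ x → element (index x) ≈ x

  index-injective : ∀ {x y} → index x ≡ index y → x ≈ y
  index-injective {x} {y} eq = S.trans (S.sym (element-index x))
    (S.trans (S.reflexive (≡.cong element eq)) (element-index y))
    where module S = Setoid S

  _≟ᶠ_ : ∀ x y → Dec (x ≈ y)
  x ≟ᶠ y = map′ index-injective index-cong (index x Finₚ.≟ index y)

  abstract
    search : {P : Carrier → Set} → (∀ {x y} → x ≈ y → P x → P y) →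
             (∀ x → Dec (P x)) → Dec (∃ P)
    search resp P? = map′ (λ (i , Pi) → element i , Pi)
      (λ (x , Px) → index x , resp (Setoid.sym S (element-index x)) Px)
      (Finₚ.any? (P? ∘ element))

Fin-finite : ∀ N → Finite (≡.setoid (Fin N)) N
Fin-finite N = record
  { index = λ i → i ; element = λ i → i ; index-cong = λ eq → eq
  ; index-element = λ _ → ≡.refl ; element-index = λ _ → ≡.refl }

×-finite : ∀ {S T M N} → Finite S M → Finite T N → Finite (S ×ₛ T) (M ℕ.* N)
×-finite {S} {T} {M} {N} fS fT = record
  { index         = λ (x , y) → combine (S.index x) (T.index y)
  ; element       = λ i → S.element (proj₁ (split i)) , T.element (proj₂ (split i))
  ; index-cong    = λ (p , q) → ≡.cong₂ combine (S.index-cong p) (T.index-cong q)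
  ; index-element = λ i → ≡.trans (≡.cong₂ combine (S.index-element (proj₁ (split i)))
                                               (T.index-element (proj₂ (split i))))
                                (Finₚ.combine-remQuot {M} N i)
  ; element-index = λ (x , y) →
      let eq = Finₚ.remQuot-combine (S.index x) (T.index y) in
      Setoid.trans S (Setoid.reflexive S (≡.cong (S.element ∘ proj₁) eq)) (S.element-index x) ,
      Setoid.trans T (Setoid.reflexive T (≡.cong (T.element ∘ proj₂) eq)) (T.element-index y)
  }
  where
  module S = Finite fS
  module T = Finite fT
  split : Fin (M ℕ.* N) → Fin M × Fin N
  split = remQuot N

vector-finite : ∀ {S N} m → Finite S N → Finite (≋-setoid S m) (N ℕ.^ m)
vector-finite {S} {N} m fS = record
  { index         = λ x → funToFin (index ∘ x)
  ; element       = λ i → element ∘ finToFun {N} {m} i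
  ; index-cong    = λ x≈y → funToFin-cong (λ i → index-cong (x≈y i))
  ; index-element = λ i → ≡.trans
      (funToFin-cong {m} {g = finToFun {N} {m} i} (λ j → index-element (finToFun {N} {m} i j)))
      (Finₚ.funToFin-finToFin {m} i)
  ; element-index = λ x j → Setoid.trans S
      (Setoid.reflexive S (≡.cong element (Finₚ.finToFun-funToFin (index ∘ x) j)))
      (element-index (x j))
  }
  where
  open Finite fS
  funToFin-cong : ∀ {m} {f g : Fin m → Fin N} → (∀ i → f i ≡ g i) → funToFin f ≡ funToFin g
  funToFin-cong {zero}  eq = ≡.refl
  funToFin-cong {suc m} eq = ≡.cong₂ combine (eq zero) (funToFin-cong (eq ∘ suc))

module _ {S T : Setoid 0ℓ 0ℓ} {M N : ℕ} (fS : Finite S M) (fT : Finite T N) where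
  private
    module S = Setoid S
    module T = Setoid T
    module FS = Finite fS
    module FT = Finite fT

  abstract
    collision : N ℕ.< M → (f : S.Carrier → T.Carrier) →
                ∃₂ λ x y → ¬ (x S.≈ y) × f x T.≈ f y
    collision N<M f with i , j , i<j , eq ← Finₚ.pigeonhole N<M (FT.index ∘ f ∘ FS.element) =
      FS.element i , FS.element j ,
      (λ eq′ → Finₚ.<⇒≢ i<j (≡.trans (≡.sym (FS.index-element i))
                               (≡.trans (FS.index-cong eq′) (FS.index-element j)))) ,
      FT.index-injective eq

  module _ (f : S.Carrier → T.Carrier) (f-cong : ∀ {x y} → x S.≈ y → f x T.≈ f y) where

    hit? : ∀ y → Dec (∃ λ x → f x T.≈ y)
    hit? y = FS.search (λ x≈x′ fx≈y → T.trans (f-cong (S.sym x≈x′)) fx≈y) (λ x → f x FT.≟ᶠ y)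

    abstract
      -- If the search finds no missed point, every point has a preimage, and choosing preimages
      -- injects the larger set into the smaller one.
      unhit : M ℕ.< N → ∃ λ y → ∀ x → ¬ (f x T.≈ y)
      unhit M<N with FT.search (λ y≈y′ no-x x eq → no-x x (T.trans eq (T.sym y≈y′)))
                               (λ y → map′ (λ ¬∃ x eq → ¬∃ (x , eq)) (λ ∀¬ (x , eq) → ∀¬ x eq) (¬? (hit? y)))
      ... | yes found = found
      ... | no  none  = ⊥-elim (Finₚ.<⇒notInjective M<N preimage-injective)
        where
        preimage : ∀ y → ∃ λ x → f x T.≈ y
        preimage y = decidable-stable (hit? y) λ ¬hit → none (y , λ x eq → ¬hit (x , eq))
        preimage-injective : ∀ {i j} → FS.index (proj₁ (preimage (FT.element i))) ≡
                                       FS.index (proj₁ (preimage (FT.element j))) → i ≡ j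
        preimage-injective {i} {j} eq = ≡.trans (≡.sym (FT.index-element i)) (≡.trans
          (FT.index-cong (T.trans (T.sym (proj₂ (preimage (FT.element i))))
            (T.trans (f-cong (FS.index-injective eq)) (proj₂ (preimage (FT.element j))))))
          (FT.index-element j))

  -- A missed point y could serve as the image of one additional element, giving an injection from
  -- `suc M` elements into N.
  injective⇒¬missed : N ℕ.≤ M → (f : S.Carrier → T.Carrier) →
    (∀ x x′ → f x T.≈ f x′ → x S.≈ x′) → ∀ y → ¬ (∀ x → ¬ (f x T.≈ y))
  injective⇒¬missed N≤M f f-injective y missed =
    Finₚ.<⇒notInjective {f = extend} (ℕ.s≤s N≤M) extend-injective
    where
    extend : Fin (suc M) → Fin N
    extend zero    = FT.index y
    extend (suc i) = FT.index (f (FS.element i))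
    extend-injective : ∀ {i j} → extend i ≡ extend j → i ≡ j
    extend-injective {zero}  {zero}  eq = ≡.refl
    extend-injective {zero}  {suc j} eq = ⊥-elim (missed _ (FT.index-injective (≡.sym eq)))
    extend-injective {suc i} {zero}  eq = ⊥-elim (missed _ (FT.index-injective eq))
    extend-injective {suc i} {suc j} eq = ≡.cong suc (≡.trans (≡.sym (FS.index-element i))
      (≡.trans (FS.index-cong (f-injective _ _ (FT.index-injective eq))) (FS.index-element j)))

  abstract
    injective⇒surjective : N ℕ.≤ M → (f : S.Carrier → T.Carrier) →
      (∀ {x y} → x S.≈ y → f x T.≈ f y) →
      (∀ x x′ → f x T.≈ f x′ → x S.≈ x′) → ∀ y → ∃ λ x → f x T.≈ y
    injective⇒surjective N≤M f f-cong f-injective y =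
      decidable-stable (hit? f f-cong y) λ ¬hit →
        injective⇒¬missed N≤M f f-injective y (λ x eq → ¬hit (x , eq))

-- The library's ring solver over an abstract ring cannot cancel x − x;
-- with integer coefficients it can.
module IntegerSolver (R : CommutativeRing 0ℓ 0ℓ) where
  open CommutativeRing R
  open Algebra.Properties.Ring ring
  open Algebra.Properties.AbelianGroup +-abelianGroup using (⁻¹-∙-comm; ε⁻¹≈ε; ⁻¹-involutive)
  open Algebra.Properties.Semiring.Mult.TCOptimised semiring using (1+×; ×-homo-+; ×1-homo-*) renaming (_×_ to _×ₙ_)
  open SetoidReasoning setoid

  private
    ⟦_⟧ : ℤ → Carrier
    ⟦ + n ⟧      = n ×ₙ 1#
    ⟦ -[1+ n ] ⟧ = - (suc n ×ₙ 1#)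

    ⊖-homo : ∀ m n → ⟦ m ⊖ n ⟧ ≈ m ×ₙ 1# - n ×ₙ 1#
    ⊖-homo zero    zero    = sym (-‿inverseʳ 0#)
    ⊖-homo zero    (suc n) = sym (+-identityˡ _)
    ⊖-homo (suc m) zero    = sym (trans (+-congˡ ε⁻¹≈ε) (+-identityʳ _))
    ⊖-homo (suc m) (suc n) = begin
      ⟦ suc m ⊖ suc n ⟧                    ≡⟨ ≡.cong ⟦_⟧ (ℤₚ.[1+m]⊖[1+n]≡m⊖n m n) ⟩
      ⟦ m ⊖ n ⟧                            ≈⟨ ⊖-homo m n ⟩
      m ×ₙ 1# - n ×ₙ 1#                      ≈⟨ +-congʳ (+-identityʳ _) ⟨
      m ×ₙ 1# + 0# - n ×ₙ 1#                 ≈⟨ +-congʳ (+-congˡ (-‿inverseʳ 1#)) ⟨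
      m ×ₙ 1# + (1# - 1#) - n ×ₙ 1#          ≈⟨ +-congʳ (+-assoc _ _ _) ⟨
      m ×ₙ 1# + 1# - 1# - n ×ₙ 1#            ≈⟨ +-assoc _ _ _ ⟩
      m ×ₙ 1# + 1# + (- 1# - n ×ₙ 1#)        ≈⟨ +-cong (+-comm _ _) (⁻¹-∙-comm _ _) ⟩
      1# + m ×ₙ 1# - (1# + n ×ₙ 1#)          ≈⟨ +-cong (1+× m 1#) (-‿cong (1+× n 1#)) ⟨
      suc m ×ₙ 1# - suc n ×ₙ 1#              ∎

    +-homo : ∀ i j → ⟦ i ℤ.+ j ⟧ ≈ ⟦ i ⟧ + ⟦ j ⟧
    +-homo (+ m)      (+ n)      = ×-homo-+ 1# m n
    +-homo (+ m)      -[1+ n ]   = ⊖-homo m (suc n)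
    +-homo -[1+ m ]   (+ n)      = trans (⊖-homo n (suc m)) (+-comm _ _)
    +-homo -[1+ m ]   -[1+ n ]   = begin
      - (suc (suc (m ℕ.+ n)) ×ₙ 1#)       ≡⟨ ≡.cong (λ k → - (suc k ×ₙ 1#)) (ℕₚ.+-suc m n) ⟨
      - ((suc m ℕ.+ suc n) ×ₙ 1#)         ≈⟨ -‿cong (×-homo-+ 1# (suc m) (suc n)) ⟩
      - (suc m ×ₙ 1# + suc n ×ₙ 1#)        ≈⟨ ⁻¹-∙-comm _ _ ⟨
      - (suc m ×ₙ 1#) - suc n ×ₙ 1#        ∎

    -‿homo : ∀ i → ⟦ ℤ.- i ⟧ ≈ - ⟦ i ⟧
    -‿homo (+ zero)   = sym ε⁻¹≈ε
    -‿homo (+ suc n)  = refl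
    -‿homo -[1+ n ]   = sym (⁻¹-involutive _)

    -◃-homo : ∀ n → ⟦ Sign.- ◃ n ⟧ ≈ - (n ×ₙ 1#)
    -◃-homo zero    = sym ε⁻¹≈ε
    -◃-homo (suc n) = refl

    +◃-homo : ∀ n → ⟦ Sign.+ ◃ n ⟧ ≈ n ×ₙ 1#
    +◃-homo zero    = refl
    +◃-homo (suc n) = refl

    *-homo : ∀ i j → ⟦ i ℤ.* j ⟧ ≈ ⟦ i ⟧ * ⟦ j ⟧
    *-homo (+ m)    (+ n)    = trans (+◃-homo (m ℕ.* n)) (×1-homo-* m n)
    *-homo (+ m)    -[1+ n ] = trans (-◃-homo (m ℕ.* suc n))
      (trans (-‿cong (×1-homo-* m (suc n))) (-‿distribʳ-* _ _))
    *-homo -[1+ m ] (+ n)    = trans (-◃-homo (suc m ℕ.* n))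
      (trans (-‿cong (×1-homo-* (suc m) n)) (-‿distribˡ-* _ _))
    *-homo -[1+ m ] -[1+ n ] = trans (+◃-homo (suc m ℕ.* suc n)) (begin
      (suc m ℕ.* suc n) ×ₙ 1#                ≈⟨ ×1-homo-* (suc m) (suc n) ⟩
      (suc m ×ₙ 1#) * (suc n ×ₙ 1#)           ≈⟨ ⁻¹-involutive _ ⟨
      - - ((suc m ×ₙ 1#) * (suc n ×ₙ 1#))     ≈⟨ -‿cong (-‿distribʳ-* _ _) ⟩
      - ((suc m ×ₙ 1#) * - (suc n ×ₙ 1#))     ≈⟨ -‿distribˡ-* _ _ ⟩
      - (suc m ×ₙ 1#) * - (suc n ×ₙ 1#)       ∎)

    homo : ℤ.+-*-rawRing -Raw-AlmostCommutative⟶ fromCommutativeRing R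
    homo = record
      { ⟦_⟧ = ⟦_⟧ ; +-homo = +-homo ; *-homo = *-homo ; -‿homo = -‿homo
      ; 0-homo = refl ; 1-homo = refl }

    _coeff≟_ : ∀ i j → Maybe (⟦ i ⟧ ≈ ⟦ j ⟧)
    i coeff≟ j with i ℤₚ.≟ j
    ... | yes eq = just (reflexive (≡.cong ⟦_⟧ eq))
    ... | no  _  = nothing

  open Algebra.Solver.Ring ℤ.+-*-rawRing (fromCommutativeRing R) homo _coeff≟_ public
    using (solve; _:=_; _:+_; _:*_; :-_; _:-_; con)

-- Fields, images of natural numbers, and linear combinations of vectors.

module FieldProperties (F : CommutativeRing 0ℓ 0ℓ) (isField : IsField F) where
  open CommutativeRing F hiding (zero)
  open IsField isField
  open IntegerSolver F
  open SetoidReasoning setoid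

  0≉1 : ¬ (0# ≈ 1#)
  0≉1 eq = 1≉0 (sym eq)

  x-y≈0⇒x≈y : ∀ {x y} → x - y ≈ 0# → x ≈ y
  x-y≈0⇒x≈y {x} {y} eq = begin
    x            ≈⟨ solve 2 (λ x y → x := (x :- y) :+ y) refl x y ⟩
    (x - y) + y  ≈⟨ +-congʳ eq ⟩
    0# + y       ≈⟨ +-identityˡ y ⟩
    y            ∎

  x≈y⇒x-y≈0 : ∀ {x y} → x ≈ y → x - y ≈ 0#
  x≈y⇒x-y≈0 {x} {y} eq = trans (+-congʳ eq) (-‿inverseʳ y)

  no-zero-divisor : ∀ {x y} → ¬ (x ≈ 0#) → x * y ≈ 0# → y ≈ 0#
  no-zero-divisor {x} {y} x≉0 xy≈0 with x⁻¹ , xx⁻¹≈1 ← inverse x x≉0 = begin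
    y               ≈⟨ *-identityˡ y ⟨
    1# * y          ≈⟨ *-congʳ xx⁻¹≈1 ⟨
    x * x⁻¹ * y     ≈⟨ solve 3 (λ x z y → x :* z :* y := z :* (x :* y)) refl x x⁻¹ y ⟩
    x⁻¹ * (x * y)   ≈⟨ *-congˡ xy≈0 ⟩
    x⁻¹ * 0#        ≈⟨ zeroʳ _ ⟩
    0#              ∎

  unit≉0 : ∀ {x y} → x * y ≈ 1# → ¬ (x ≈ 0#)
  unit≉0 {x} {y} xy≈1 x≈0 = 1≉0 (trans (sym xy≈1) (trans (*-congʳ x≈0) (zeroˡ y)))

  ι : ℕ → Carrier
  ι m = natMul F m 1#

  natMul≈ι* : ∀ m x → natMul F m x ≈ ι m * x
  natMul≈ι* zero    x = sym (zeroˡ x)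
  natMul≈ι* (suc m) x = trans (+-congˡ (natMul≈ι* m x))
    (solve 2 (λ x i → x :+ i :* x := (con (+ 1) :+ i) :* x) refl x (ι m))

  ι-+ : ∀ m n → ι (m ℕ.+ n) ≈ ι m + ι n
  ι-+ zero    n = sym (+-identityˡ _)
  ι-+ (suc m) n = trans (+-congˡ (ι-+ m n)) (sym (+-assoc _ _ _))

  ι-* : ∀ m n → ι (m ℕ.* n) ≈ ι m * ι n
  ι-* zero    n = sym (zeroˡ _)
  ι-* (suc m) n = trans (ι-+ n (m ℕ.* n)) (trans (+-congˡ (ι-* m n))
    (solve 2 (λ i j → j :+ i :* j := (con (+ 1) :+ i) :* j) refl (ι m) (ι n)))

  infix 8 _·_[_]
  _·_[_] : ∀ {m n} → (Fin m → Carrier) → (Fin m → Vector F n) → Fin (suc n) → Carrier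
  a · u [ j ] = linComb F a u j

  module _ {n : ℕ} where

    ·-cong : ∀ {m} {a b : Fin m → Carrier} (u : Fin m → Vector F n) →
             (∀ i → a i ≈ b i) → ∀ j → a · u [ j ] ≈ b · u [ j ]
    ·-cong {zero}  u a≈b j = refl
    ·-cong {suc m} u a≈b j = +-cong (*-congʳ (a≈b zero)) (·-cong (u ∘ suc) (a≈b ∘ suc) j)

    ·-+ : ∀ {m} (a b : Fin m → Carrier) (u : Fin m → Vector F n) →
          ∀ j → (λ i → a i + b i) · u [ j ] ≈ a · u [ j ] + b · u [ j ]
    ·-+ {zero}  a b u j = sym (+-identityˡ 0#)
    ·-+ {suc m} a b u j = trans (+-congˡ (·-+ (a ∘ suc) (b ∘ suc) (u ∘ suc) j))
      (solve 5 (λ a b u x y → (a :+ b) :* u :+ (x :+ y) := (a :* u :+ x) :+ (b :* u :+ y)) refl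
        (a zero) (b zero) (u zero j) _ _)

    ·-- : ∀ {m} (a b : Fin m → Carrier) (u : Fin m → Vector F n) →
          ∀ j → (λ i → a i - b i) · u [ j ] ≈ a · u [ j ] - b · u [ j ]
    ·-- {zero}  a b u j = sym (-‿inverseʳ 0#)
    ·-- {suc m} a b u j = trans (+-congˡ (·-- (a ∘ suc) (b ∘ suc) (u ∘ suc) j))
      (solve 5 (λ a b u x y → (a :- b) :* u :+ (x :- y) := (a :* u :+ x) :- (b :* u :+ y)) refl
        (a zero) (b zero) (u zero j) _ _)

    ·-* : ∀ {m} c (a : Fin m → Carrier) (u : Fin m → Vector F n) →
          ∀ j → (λ i → c * a i) · u [ j ] ≈ c * a · u [ j ]
    ·-* {zero}  c a u j = sym (zeroʳ c)
    ·-* {suc m} c a u j = trans (+-congˡ (·-* c (a ∘ suc) (u ∘ suc) j))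
      (solve 4 (λ c a u x → c :* a :* u :+ c :* x := c :* (a :* u :+ x)) refl
        c (a zero) (u zero j) _)

    ·-0 : ∀ {m} {a : Fin m → Carrier} (u : Fin m → Vector F n) →
          (∀ i → a i ≈ 0#) → ∀ j → a · u [ j ] ≈ 0#
    ·-0 {zero}  u a≈0 j = refl
    ·-0 {suc m} u a≈0 j = trans (+-cong (trans (*-congʳ (a≈0 zero)) (zeroˡ _))
                                        (·-0 (u ∘ suc) (a≈0 ∘ suc) j)) (+-identityˡ 0#)

-- Sums over the finite field F and its prime subfield.

module FiniteFieldProperties (F : CommutativeRing 0ℓ 0ℓ) (isField : IsField F)
  (p h : ℕ) (p-prime : Prime p) (hasSize : HasSize F (p ℕ.^ h)) where
  open CommutativeRing F hiding (zero)
  open IsField isField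
  open FieldProperties F isField
  open IntegerSolver F
  open SetoidReasoning setoid
  open Algebra.Properties.Semiring.Sum semiring

  q : ℕ
  q = p ℕ.^ h

  private
    e : Fin q → Carrier
    e = proj₁ hasSize
    e-injective : ∀ i j → e i ≈ e j → i ≡ j
    e-injective = proj₁ (proj₂ hasSize)
    e-surjective : ∀ x → Σ (Fin q) λ i → e i ≈ x
    e-surjective = proj₂ (proj₂ hasSize)

  F-finite : Finite setoid q
  F-finite = record
    { index         = proj₁ ∘ e-surjective
    ; element       = e
    ; index-cong    = λ {x} {y} x≈y → e-injective _ _
        (trans (proj₂ (e-surjective x)) (trans x≈y (sym (proj₂ (e-surjective y)))))
    ; index-element = λ i → e-injective _ _ (proj₂ (e-surjective (e i)))
    ; element-index = proj₂ ∘ e-surjective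
    }

  open Finite F-finite using (index; index-cong; index-element; element-index) renaming (_≟ᶠ_ to _≟_) public

  opaque
    ∑ᶠ : (Carrier → Carrier) → Carrier
    ∑ᶠ φ = sum (φ ∘ e)

    ∑ᶠ-cong : ∀ {φ ψ} → (∀ x → φ x ≈ ψ x) → ∑ᶠ φ ≈ ∑ᶠ ψ
    ∑ᶠ-cong φ≈ψ = sum-cong-≋ (φ≈ψ ∘ e)

    ∑ᶠ-+ : ∀ φ ψ → ∑ᶠ (λ x → φ x + ψ x) ≈ ∑ᶠ φ + ∑ᶠ ψ
    ∑ᶠ-+ φ ψ = ∑-distrib-+ (φ ∘ e) (ψ ∘ e)

    ∑ᶠ-* : ∀ c φ → ∑ᶠ (λ x → c * φ x) ≈ c * ∑ᶠ φ
    ∑ᶠ-* c φ = sym (*-distribˡ-sum c (φ ∘ e))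

    ∑ᶠ-reindex : ∀ {φ} → (∀ {x y} → x ≈ y → φ x ≈ φ y) →
      (f g : Carrier → Carrier) → (∀ {x y} → x ≈ y → f x ≈ f y) → (∀ {x y} → x ≈ y → g x ≈ g y) →
      (∀ x → f (g x) ≈ x) → (∀ x → g (f x) ≈ x) → ∑ᶠ (φ ∘ f) ≈ ∑ᶠ φ
    ∑ᶠ-reindex {φ} φ-cong f g f-cong g-cong fg gf = sym (begin
      ∑ᶠ φ                            ≈⟨ sum-permute (φ ∘ e) π ⟩
      sum (φ ∘ e ∘ index ∘ f ∘ e)     ≈⟨ sum-cong-≋ (λ i → φ-cong (element-index (f (e i)))) ⟩
      ∑ᶠ (φ ∘ f)                      ∎)
      where
      inv : ∀ {f g : Carrier → Carrier} → (∀ {x y} → x ≈ y → f x ≈ f y) → (∀ x → f (g x) ≈ x) →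
            ∀ i → index (f (e (index (g (e i))))) ≡ i
      inv f-cong fg i = ≡.trans (index-cong (trans (f-cong (element-index _)) (fg (e i)))) (index-element i)
      π : Perm.Permutation q q
      π = Perm.permutation (index ∘ f ∘ e) (index ∘ g ∘ e) (inv f-cong fg) (inv g-cong gf)

    ∑ᶠ-point : ∀ {φ} → (∀ {x y} → x ≈ y → φ x ≈ φ y) → ∀ x₀ →
               (∀ x → ¬ (x ≈ x₀) → φ x ≈ 0#) → ∑ᶠ φ ≈ φ x₀
    ∑ᶠ-point {φ} φ-cong x₀ vanish = trans
      (sum-point (φ ∘ e) (index x₀) λ j j≢ → vanish _ λ eq →
        j≢ (≡.trans (≡.sym (index-element j)) (index-cong eq)))
      (φ-cong (element-index x₀))
      where
      sum-zero : ∀ {m} (t : (Fin m → Carrier)) → (∀ i → t i ≈ 0#) → sum t ≈ 0#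
      sum-zero {zero}  t t≈0 = refl
      sum-zero {suc m} t t≈0 = trans (+-cong (t≈0 zero) (sum-zero (t ∘ suc) (t≈0 ∘ suc))) (+-identityˡ 0#)
      sum-point : ∀ {m} (t : (Fin m → Carrier)) i → (∀ j → ¬ (j ≡ i) → t j ≈ 0#) → sum t ≈ t i
      sum-point t zero    t≈0 = trans (+-congˡ (sum-zero (t ∘ suc) (λ j → t≈0 (suc j) λ ()))) (+-identityʳ _)
      sum-point t (suc i) t≈0 = trans (+-cong (t≈0 zero λ ())
        (sum-point (t ∘ suc) i (λ j j≢i → t≈0 (suc j) (j≢i ∘ Finₚ.suc-injective)))) (+-identityˡ _)

  ∑ᶠ-shift : ∀ {φ} → (∀ {x y} → x ≈ y → φ x ≈ φ y) → ∀ c → ∑ᶠ (λ x → φ (x + c)) ≈ ∑ᶠ φ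
  ∑ᶠ-shift φ-cong c = ∑ᶠ-reindex φ-cong (_+ c) (_- c) +-congʳ +-congʳ
    (λ x → solve 2 (λ x c → x :- c :+ c := x) refl x c)
    (λ x → solve 2 (λ x c → x :+ c :- c := x) refl x c)

  -- The substitution x ↦ x + c permutes F, so adding c to every term of ∑ x does not change that
  -- sum.
  ∑ᶠ-const : ∀ c → ∑ᶠ (λ _ → c) ≈ 0#
  ∑ᶠ-const c = begin
    ∑ᶠ (λ _ → c)                                  ≈⟨ solve 2 (λ s t → t := s :+ t :- s) refl (∑ᶠ (λ x → x)) _ ⟩
    ∑ᶠ (λ x → x) + ∑ᶠ (λ _ → c) - ∑ᶠ (λ x → x)    ≈⟨ +-congʳ (∑ᶠ-+ (λ x → x) (λ _ → c)) ⟨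
    ∑ᶠ (λ x → x + c) - ∑ᶠ (λ x → x)               ≈⟨ x≈y⇒x-y≈0 (∑ᶠ-shift (λ eq → eq) c) ⟩
    0#                                            ∎

  -- Multiplication by the unit μ permutes F, so (μ - 1) ∑ x = 0. This excludes the field of two
  -- elements, where ∑ x = 1.
  ∑ᶠ-id : ∀ μ → ¬ (μ ≈ 0#) → ¬ (μ ≈ 1#) → ∑ᶠ (λ x → x) ≈ 0#
  ∑ᶠ-id μ μ≉0 μ≉1 with ν , μν≈1 ← inverse μ μ≉0 =
    no-zero-divisor (λ eq → μ≉1 (x-y≈0⇒x≈y eq)) (begin
      (μ - 1#) * ∑ᶠ (λ x → x)             ≈⟨ solve 2 (λ m s → (m :- con (+ 1)) :* s := m :* s :- s) refl μ _ ⟩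
      μ * ∑ᶠ (λ x → x) - ∑ᶠ (λ x → x)     ≈⟨ +-congʳ (∑ᶠ-* μ (λ x → x)) ⟨
      ∑ᶠ (λ x → μ * x) - ∑ᶠ (λ x → x)     ≈⟨ x≈y⇒x-y≈0 (∑ᶠ-reindex (λ eq → eq) (μ *_) (ν *_) *-congˡ *-congˡ
                                               (cancel μν≈1) (cancel (trans (*-comm ν μ) μν≈1))) ⟩
      0#                                  ∎)
    where
    cancel : ∀ {a b} → a * b ≈ 1# → ∀ x → a * (b * x) ≈ x
    cancel ab≈1 x = trans (sym (*-assoc _ _ _)) (trans (*-congʳ ab≈1) (*-identityˡ x))

  opaque
    unfolding ∑ᶠ

    ιq≈0 : ι q ≈ 0#
    ιq≈0 = trans (sym (sum-const q)) (∑ᶠ-const 1#)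
      where
      sum-const : ∀ m → sum {m} (λ _ → 1#) ≈ ι m
      sum-const zero    = refl
      sum-const (suc m) = +-congˡ (sum-const m)

  -- Only the cardinality of F is given. From q · 1 = 0 the characteristic follows because a power
  -- of p vanishes in a field only if p does.
  ιp≈0 : ι p ≈ 0#
  ιp≈0 = root h ιq≈0
    where
    root : ∀ h → ι (p ℕ.^ h) ≈ 0# → ι p ≈ 0#
    root zero    eq = ⊥-elim (1≉0 (trans (sym (+-identityʳ 1#)) eq))
    root (suc h) eq with ι p ≟ 0#
    ... | yes ιp≈0 = ιp≈0
    ... | no  ιp≉0 = root h (no-zero-divisor ιp≉0 (trans (sym (ι-* p (p ℕ.^ h))) eq))

  private instance
    p-nonZero : ℕ.NonZero p
    p-nonZero = prime⇒nonZero p-prime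

  ι-multiple : ∀ m → ι (m ℕ.* p) ≈ 0#
  ι-multiple m = trans (ι-* m p) (trans (*-congˡ ιp≈0) (zeroʳ _))

  𝔽ₚ : Carrier → Set
  𝔽ₚ x = Σ (Fin p) λ i → x ≈ ι (toℕ i)

  𝔽ₚ-resp : ∀ {x y} → x ≈ y → 𝔽ₚ x → 𝔽ₚ y
  𝔽ₚ-resp x≈y (i , x≈i) = i , trans (sym x≈y) x≈i

  𝔽ₚ? : ∀ x → Dec (𝔽ₚ x)
  𝔽ₚ? x = Finₚ.any? (λ i → x ≟ ι (toℕ i))

  𝔽ₚ-ι : ∀ m → 𝔽ₚ (ι m)
  𝔽ₚ-ι m = fromℕ< (m%n<n m p) , (begin
    ι m                                 ≡⟨ ≡.cong ι (m≡m%n+[m/n]*n m p) ⟩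
    ι (m % p ℕ.+ m / p ℕ.* p)           ≈⟨ ι-+ (m % p) _ ⟩
    ι (m % p) + ι (m / p ℕ.* p)         ≈⟨ +-congˡ (ι-multiple (m / p)) ⟩
    ι (m % p) + 0#                      ≈⟨ +-identityʳ _ ⟩
    ι (m % p)                           ≡⟨ ≡.cong ι (Finₚ.toℕ-fromℕ< (m%n<n m p)) ⟨
    ι (toℕ (fromℕ< (m%n<n m p)))        ∎)

  𝔽ₚ-0 : 𝔽ₚ 0#
  𝔽ₚ-0 = 𝔽ₚ-ι 0

  𝔽ₚ-1 : 𝔽ₚ 1#
  𝔽ₚ-1 = 𝔽ₚ-resp (+-identityʳ 1#) (𝔽ₚ-ι 1)

  𝔽ₚ-+ : ∀ {x y} → 𝔽ₚ x → 𝔽ₚ y → 𝔽ₚ (x + y)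
  𝔽ₚ-+ (i , x≈i) (j , y≈j) = 𝔽ₚ-resp (trans (ι-+ (toℕ i) (toℕ j)) (sym (+-cong x≈i y≈j))) (𝔽ₚ-ι (toℕ i ℕ.+ toℕ j))

  𝔽ₚ-* : ∀ {x y} → 𝔽ₚ x → 𝔽ₚ y → 𝔽ₚ (x * y)
  𝔽ₚ-* (i , x≈i) (j , y≈j) = 𝔽ₚ-resp (trans (ι-* (toℕ i) (toℕ j)) (sym (*-cong x≈i y≈j))) (𝔽ₚ-ι (toℕ i ℕ.* toℕ j))

  𝔽ₚ-neg : ∀ {x} → 𝔽ₚ x → 𝔽ₚ (- x)
  𝔽ₚ-neg {x} x∈ = 𝔽ₚ-resp (begin
      ι (ℕ.pred p) * x                  ≈⟨ solve 2 (λ i x → i :* x := (con (+ 1) :+ i) :* x :- x) refl _ x ⟩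
      ι (suc (ℕ.pred p)) * x - x        ≡⟨ ≡.cong (λ k → ι k * x - x) (ℕₚ.suc-pred p) ⟩
      ι p * x - x                       ≈⟨ +-congʳ (trans (*-congʳ ιp≈0) (zeroˡ x)) ⟩
      0# - x                            ≈⟨ +-identityˡ _ ⟩
      - x                               ∎) (𝔽ₚ-* (𝔽ₚ-ι (ℕ.pred p)) x∈)

  𝔽ₚ-- : ∀ {x y} → 𝔽ₚ x → 𝔽ₚ y → 𝔽ₚ (x - y)
  𝔽ₚ-- x∈ y∈ = 𝔽ₚ-+ x∈ (𝔽ₚ-neg y∈)

  -- `inverse` yields an element of F with no information about `𝔽ₚ`; the Bézout coefficients of the
  -- coprime pair `suc m`, `p` give an inverse that visibly lies there. The two cases are the two
  -- signs of Bézout's identity over ℕ.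
  ι-unit : ∀ m → suc m ℕ.< p → Σ Carrier λ y → 𝔽ₚ y × ι (suc m) * y ≈ 1#
  ι-unit m m<p with coprime-Bézout (prime⇒coprime p-prime m<p)
  ... | Bézout.+- a b eq = - ι b , 𝔽ₚ-neg (𝔽ₚ-ι b) , (begin
    ι (suc m) * - ι b                     ≈⟨ solve 2 (λ m b → m :* :- b := con (+ 1) :- (con (+ 1) :+ b :* m)) refl _ _ ⟩
    1# - (1# + ι b * ι (suc m))           ≈⟨ +-congˡ (-‿cong (+-congˡ (ι-* b (suc m)))) ⟨
    1# - ι (1 ℕ.+ b ℕ.* suc m)            ≡⟨ ≡.cong (λ k → 1# - ι k) eq ⟩
    1# - ι (a ℕ.* p)                      ≈⟨ +-congˡ (-‿cong (ι-multiple a)) ⟩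
    1# - 0#                               ≈⟨ solve 0 (con (+ 1) :- con (+ 0) := con (+ 1)) refl ⟩
    1#                                    ∎)
  ... | Bézout.-+ a b eq = ι b , 𝔽ₚ-ι b , (begin
    ι (suc m) * ι b                       ≈⟨ *-comm _ _ ⟩
    ι b * ι (suc m)                       ≈⟨ ι-* b (suc m) ⟨
    ι (b ℕ.* suc m)                       ≡⟨ ≡.cong ι eq ⟨
    1# + ι (a ℕ.* p)                      ≈⟨ +-congˡ (ι-multiple a) ⟩
    1# + 0#                               ≈⟨ +-identityʳ 1# ⟩
    1#                                    ∎)

  𝔽ₚ-inverse : ∀ {x} → 𝔽ₚ x → ¬ (x ≈ 0#) → Σ Carrier λ y → 𝔽ₚ y × x * y ≈ 1#
  𝔽ₚ-inverse {x} (i , x≈i) x≉0 = go (toℕ i) (Finₚ.toℕ<n i) x≈i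
    where
    go : ∀ m → m ℕ.< p → x ≈ ι m → Σ Carrier λ y → 𝔽ₚ y × x * y ≈ 1#
    go zero    _   x≈0 = ⊥-elim (x≉0 x≈0)
    go (suc m) m<p x≈m with y , y∈ , eq ← ι-unit m m<p = y , y∈ , trans (*-congʳ x≈m) eq

  ι-distinct : ∀ {i j} → i ℕ.< j → j ℕ.< p → ¬ (ι i ≈ ι j)
  ι-distinct {i} {j} i<j j<p eq with k , ≡.refl ← ℕₚ.m≤n⇒∃[o]m+o≡n i<j
    with y , _ , unit ← ι-unit k (ℕₚ.≤-<-trans (ℕ.s≤s (ℕₚ.m≤n+m k i)) j<p) =
    unit≉0 unit (begin
      ι (suc k)                     ≈⟨ solve 2 (λ k i → k := i :+ k :- i) refl _ (ι i) ⟩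
      ι i + ι (suc k) - ι i         ≈⟨ +-congʳ (ι-+ i (suc k)) ⟨
      ι (i ℕ.+ suc k) - ι i         ≡⟨ ≡.cong (λ m → ι m - ι i) (ℕₚ.+-suc i k) ⟩
      ι (suc i ℕ.+ k) - ι i         ≈⟨ x≈y⇒x-y≈0 (sym eq) ⟩
      0#                            ∎)

  ι-injective : ∀ {i j : Fin p} → ι (toℕ i) ≈ ι (toℕ j) → i ≡ j
  ι-injective {i} {j} eq with ℕₚ.<-cmp (toℕ i) (toℕ j)
  ... | tri< i<j _ _ = ⊥-elim (ι-distinct i<j (Finₚ.toℕ<n j) eq)
  ... | tri≈ _ i≡j _ = Finₚ.toℕ-injective i≡j
  ... | tri> _ _ j<i = ⊥-elim (ι-distinct j<i (Finₚ.toℕ<n i) (sym eq))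

-- Sums over coordinate tuples.

module VectorSums (F : CommutativeRing 0ℓ 0ℓ) (isField : IsField F)
  (p h : ℕ) (p-prime : Prime p) (hasSize : HasSize F (p ℕ.^ h)) where
  open CommutativeRing F hiding (zero)
  open IsField isField
  open FieldProperties F isField
  open FiniteFieldProperties F isField p h p-prime hasSize
  open IntegerSolver F
  open SetoidReasoning setoid

  Tuple : ℕ → Set
  Tuple m = Fin m → Carrier

  infix 4 _≋_
  _≋_ : ∀ {m} → Tuple m → Tuple m → Set
  x ≋ y = ∀ i → x i ≈ y i

  Tuple-finite : ∀ m → Finite (≋-setoid setoid m) (q ℕ.^ m)
  Tuple-finite m = vector-finite m F-finite

  _≋?_ : ∀ {m} (x y : Tuple m) → Dec (x ≋ y)
  x ≋? y = Finₚ.all? (λ i → x i ≟ y i)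

  Congruent : ∀ {m} → (Tuple m → Carrier) → Set
  Congruent φ = ∀ {x y} → x ≋ y → φ x ≈ φ y

  ∷-cong : ∀ {m a b} {x y : Tuple m} → a ≈ b → x ≋ y → (a ∷ᵥ x) ≋ (b ∷ᵥ y)
  ∷-cong a≈b x≋y zero    = a≈b
  ∷-cong a≈b x≋y (suc i) = x≋y i

  ∑ᵛ : ∀ m → (Tuple m → Carrier) → Carrier
  ∑ᵛ zero    φ = φ (λ ())
  ∑ᵛ (suc m) φ = ∑ᶠ λ c → ∑ᵛ m λ y → φ (c ∷ᵥ y)

  ∑ᵛ-cong : ∀ m {φ ψ : Tuple m → Carrier} → (∀ y → φ y ≈ ψ y) → ∑ᵛ m φ ≈ ∑ᵛ m ψ
  ∑ᵛ-cong zero    φ≈ψ = φ≈ψ (λ ())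
  ∑ᵛ-cong (suc m) φ≈ψ = ∑ᶠ-cong λ c → ∑ᵛ-cong m λ y → φ≈ψ (c ∷ᵥ y)

  ∑ᵛ-+ : ∀ m (φ ψ : Tuple m → Carrier) → ∑ᵛ m (λ y → φ y + ψ y) ≈ ∑ᵛ m φ + ∑ᵛ m ψ
  ∑ᵛ-+ zero    φ ψ = refl
  ∑ᵛ-+ (suc m) φ ψ = trans (∑ᶠ-cong λ c → ∑ᵛ-+ m (λ y → φ (c ∷ᵥ y)) (λ y → ψ (c ∷ᵥ y))) (∑ᶠ-+ _ _)

  ∑ᵛ-* : ∀ m c (φ : Tuple m → Carrier) → ∑ᵛ m (λ y → c * φ y) ≈ c * ∑ᵛ m φ
  ∑ᵛ-* zero    c φ = refl
  ∑ᵛ-* (suc m) c φ = trans (∑ᶠ-cong λ x → ∑ᵛ-* m c (λ y → φ (x ∷ᵥ y))) (∑ᶠ-* c _)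

  ∑ᵛ-zero : ∀ m {φ : Tuple m → Carrier} → (∀ y → φ y ≈ 0#) → ∑ᵛ m φ ≈ 0#
  ∑ᵛ-zero zero    φ≈0 = φ≈0 (λ ())
  ∑ᵛ-zero (suc m) φ≈0 = trans (∑ᶠ-cong λ c → ∑ᵛ-zero m λ y → φ≈0 (c ∷ᵥ y)) (∑ᶠ-const 0#)

  ∷-congˡ : ∀ {m} {φ : Tuple (suc m) → Carrier} → Congruent φ →
            ∀ {a b} → a ≈ b → ∑ᵛ m (λ y → φ (a ∷ᵥ y)) ≈ ∑ᵛ m (λ y → φ (b ∷ᵥ y))
  ∷-congˡ {m} φ-cong a≈b = ∑ᵛ-cong m λ y → φ-cong (∷-cong a≈b λ i → refl)

  infixl 6 _⊞_
  _⊞_ : ∀ {m} → Tuple m → Tuple m → Tuple m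
  (x ⊞ y) i = x i + y i

  ∑ᵛ-shift : ∀ m {φ : Tuple m → Carrier} → Congruent φ → ∀ t → ∑ᵛ m (λ y → φ (y ⊞ t)) ≈ ∑ᵛ m φ
  ∑ᵛ-shift zero        φ-cong t = φ-cong λ ()
  ∑ᵛ-shift (suc m) {φ} φ-cong t = begin
    ∑ᶠ (λ c → ∑ᵛ m λ y → φ ((c ∷ᵥ y) ⊞ t))
      ≈⟨ ∑ᶠ-cong (λ c → ∑ᵛ-cong m λ y → φ-cong (∷-⊞ c y)) ⟩
    ∑ᶠ (λ c → ∑ᵛ m λ y → φ ((c + t zero) ∷ᵥ (y ⊞ (t ∘ suc))))
      ≈⟨ ∑ᶠ-cong (λ c → ∑ᵛ-shift m {λ y → φ ((c + t zero) ∷ᵥ y)} (λ eq → φ-cong (∷-cong refl eq)) (t ∘ suc)) ⟩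
    ∑ᶠ (λ c → ∑ᵛ m λ y → φ ((c + t zero) ∷ᵥ y))
      ≈⟨ ∑ᶠ-shift (∷-congˡ φ-cong) (t zero) ⟩
    ∑ᶠ (λ c → ∑ᵛ m λ y → φ (c ∷ᵥ y)) ∎
    where
    ∷-⊞ : ∀ c y → ((c ∷ᵥ y) ⊞ t) ≋ ((c + t zero) ∷ᵥ (y ⊞ (t ∘ suc)))
    ∷-⊞ c y zero    = refl
    ∷-⊞ c y (suc i) = refl

  ∑ᵛ-point : ∀ m {φ : Tuple m → Carrier} → Congruent φ → ∀ y₀ →
             (∀ y → ¬ (y ≋ y₀) → φ y ≈ 0#) → ∑ᵛ m φ ≈ φ y₀
  ∑ᵛ-point zero        φ-cong y₀ vanish = φ-cong λ ()
  ∑ᵛ-point (suc m) {φ} φ-cong y₀ vanish = begin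
    ∑ᶠ (λ c → ∑ᵛ m λ y → φ (c ∷ᵥ y))
      ≈⟨ ∑ᶠ-point (∷-congˡ φ-cong) (y₀ zero) (λ c c≉ → ∑ᵛ-zero m λ y → vanish (c ∷ᵥ y) (λ eq → c≉ (eq zero))) ⟩
    ∑ᵛ m (λ y → φ (y₀ zero ∷ᵥ y))
      ≈⟨ ∑ᵛ-point m {λ y → φ (y₀ zero ∷ᵥ y)} (λ eq → φ-cong (∷-cong refl eq)) (y₀ ∘ suc)
           (λ y y≉ → vanish (y₀ zero ∷ᵥ y) λ eq → y≉ (eq ∘ suc)) ⟩
    φ (y₀ zero ∷ᵥ (y₀ ∘ suc))
      ≈⟨ φ-cong ∷-η ⟩
    φ y₀ ∎
    where
    ∷-η : (y₀ zero ∷ᵥ (y₀ ∘ suc)) ≋ y₀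
    ∷-η zero    = refl
    ∷-η (suc i) = refl

  infixr 7 _⊠_
  _⊠_ : ∀ {m} → Carrier → Tuple m → Tuple m
  (c ⊠ x) i = c * x i

  -- Each coset of the line spanned by t contributes w₀ q + τ ∑ c = 0 times a
  -- constant value of φ.
  coset-sum : ∀ {μ} → ¬ (μ ≈ 0#) → ¬ (μ ≈ 1#) →
    ∀ m {φ w : Tuple m → Carrier} → Congruent φ → Congruent w → ∀ t τ → ¬ (∀ i → t i ≈ 0#) →
    (∀ c y → φ (y ⊞ c ⊠ t) ≈ φ y) →
    (∀ c y → w (y ⊞ c ⊠ t) ≈ w y + c * τ) → ∑ᵛ m (λ y → w y * φ y) ≈ 0#
  coset-sum μ≉0 μ≉1 zero φ-cong w-cong t τ t≉0 φ-inv w-inv = ⊥-elim (t≉0 λ ())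
  coset-sum {μ} μ≉0 μ≉1 (suc m) {φ} {w} φ-cong w-cong t τ t≉0 φ-inv w-inv with t zero ≟ 0#
  ... | yes t₀≈0 = trans (∑ᶠ-cong λ c → coset-sum μ≉0 μ≉1 m {λ y → φ (c ∷ᵥ y)} {λ y → w (c ∷ᵥ y)}
          (λ eq → φ-cong (∷-cong refl eq)) (λ eq → w-cong (∷-cong refl eq)) (t ∘ suc) τ
          (λ eq → t≉0 λ { zero → t₀≈0 ; (suc i) → eq i })
          (λ b y → trans (φ-cong (move b c y)) (φ-inv b (c ∷ᵥ y)))
          (λ b y → trans (w-cong (move b c y)) (w-inv b (c ∷ᵥ y))))
        (∑ᶠ-const 0#)
    where
    move : ∀ b c (y : Tuple m) → (c ∷ᵥ (y ⊞ b ⊠ (t ∘ suc))) ≋ ((c ∷ᵥ y) ⊞ b ⊠ t)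
    move b c y zero    = sym (trans (+-congˡ (trans (*-congˡ t₀≈0) (zeroʳ b))) (+-identityʳ c))
    move b c y (suc i) = refl
  -- The tuples with first coordinate 0 represent the cosets of the line spanned by t. Translating y
  -- by `c * s` times the tail of t carries the slice at c to the slice at 0, with an integrand
  -- affine in c; the sum over c of each of its two terms vanishes.
  ... | no t₀≉0 with s , t₀s≈1 ← inverse (t zero) t₀≉0 = begin
    ∑ᶠ (λ c → ∑ᵛ m λ y → w (c ∷ᵥ y) * φ (c ∷ᵥ y))
      ≈⟨ ∑ᶠ-cong (λ c → trans (sym (∑ᵛ-shift m {λ y → w (c ∷ᵥ y) * φ (c ∷ᵥ y)}
           (λ eq → *-cong (w-cong (∷-cong refl eq)) (φ-cong (∷-cong refl eq)))
           ((c * s) ⊠ (t ∘ suc)))) (∑ᵛ-cong m (slide c))) ⟩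
    ∑ᶠ (λ c → ∑ᵛ m λ y → w (0# ∷ᵥ y) * φ (0# ∷ᵥ y) + c * (s * τ) * φ (0# ∷ᵥ y))
      ≈⟨ ∑ᶠ-cong (λ c → trans (∑ᵛ-+ m _ _) (+-congˡ (trans (∑ᵛ-* m (c * (s * τ)) (λ y → φ (0# ∷ᵥ y)))
           (solve 3 (λ c s f → c :* s :* f := s :* f :* c) refl c (s * τ) _)))) ⟩
    ∑ᶠ (λ c → ∑ᵛ m (λ y → w (0# ∷ᵥ y) * φ (0# ∷ᵥ y)) + s * τ * ∑ᵛ m (λ y → φ (0# ∷ᵥ y)) * c)
      ≈⟨ ∑ᶠ-+ _ _ ⟩
    ∑ᶠ (λ c → ∑ᵛ m (λ y → w (0# ∷ᵥ y) * φ (0# ∷ᵥ y))) + ∑ᶠ (λ c → s * τ * ∑ᵛ m (λ y → φ (0# ∷ᵥ y)) * c)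
      ≈⟨ +-cong (∑ᶠ-const _) (trans (∑ᶠ-* _ _) (trans (*-congˡ (∑ᶠ-id μ μ≉0 μ≉1)) (zeroʳ _))) ⟩
    0# + 0#
      ≈⟨ +-identityˡ 0# ⟩
    0# ∎
    where
    move : ∀ c (y : Tuple m) → (c ∷ᵥ (y ⊞ (c * s) ⊠ (t ∘ suc))) ≋ ((0# ∷ᵥ y) ⊞ (c * s) ⊠ t)
    move c y zero = begin
      c                        ≈⟨ *-identityʳ c ⟨
      c * 1#                   ≈⟨ *-congˡ t₀s≈1 ⟨
      c * (t zero * s)         ≈⟨ solve 3 (λ c t s → c :* (t :* s) := con (+ 0) :+ c :* s :* t) refl c (t zero) s ⟩
      0# + c * s * t zero      ∎
    move c y (suc i) = refl
    slide : ∀ c (y : Tuple m) →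
      w (c ∷ᵥ (y ⊞ (c * s) ⊠ (t ∘ suc))) * φ (c ∷ᵥ (y ⊞ (c * s) ⊠ (t ∘ suc))) ≈
      w (0# ∷ᵥ y) * φ (0# ∷ᵥ y) + c * (s * τ) * φ (0# ∷ᵥ y)
    slide c y = begin
      w (c ∷ᵥ (y ⊞ (c * s) ⊠ (t ∘ suc))) * φ (c ∷ᵥ (y ⊞ (c * s) ⊠ (t ∘ suc)))
        ≈⟨ *-cong (trans (w-cong (move c y)) (w-inv (c * s) (0# ∷ᵥ y)))
                  (trans (φ-cong (move c y)) (φ-inv (c * s) (0# ∷ᵥ y))) ⟩
      (w (0# ∷ᵥ y) + c * s * τ) * φ (0# ∷ᵥ y)
        ≈⟨ solve 5 (λ w c s τ f → (w :+ c :* s :* τ) :* f := w :* f :+ c :* (s :* τ) :* f) refl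
             (w (0# ∷ᵥ y)) c s τ (φ (0# ∷ᵥ y)) ⟩
      w (0# ∷ᵥ y) * φ (0# ∷ᵥ y) + c * (s * τ) * φ (0# ∷ᵥ y) ∎

-- Zeroth and first moments of codewords on the cosets of A.

module CodewordMoments (F : CommutativeRing 0ℓ 0ℓ) (isField : IsField F)
  (p h : ℕ) (p-prime : Prime p) (hasSize : HasSize F (p ℕ.^ h)) where
  open CommutativeRing F hiding (zero)
  open IsField isField
  open FieldProperties F isField
  open FiniteFieldProperties F isField p h p-prime hasSize
  open VectorSums F isField p h p-prime hasSize
  open IntegerSolver F
  open SetoidReasoning setoid

  module _ {μ} (μ≉0 : ¬ (μ ≈ 0#)) (μ≉1 : ¬ (μ ≈ 1#)) {d n : ℕ} (a : Fin d → Vector F n) where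

    infixl 6 _⊞A_
    _⊞A_ : Vector F n → Tuple d → Vector F n
    v ⊞A y = v ⊞ linComb F y a

    -- The coset v + A must miss 0, since incidence vectors and codewords have prescribed values at
    -- nonzero vectors only.
    Outside : Vector F n → Set
    Outside v = ∀ y → NonZeroV F (v ⊞A y)

    -- The zeroth and first moments of φ on the cosets v + A, A = ⟨a⟩.
    record Moments (φ : Vector F n → Carrier) : Set where
      field
        mass   : Carrier
        ℓ      : Vector F n → Tuple d
        ℓ-cong : ∀ {v w} → v ≋ w → ℓ v ≋ ℓ w
        ℓ-⊞    : ∀ v w → ℓ (v ⊞ w) ≋ ℓ v ⊞ ℓ w
        ℓ-⊠    : ∀ c v → ℓ (c ⊠ v) ≋ c ⊠ ℓ v
        -- The value dictated by translation: moving the base point of a coset by y · a replaces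
        -- each coordinate tuple y′ by y′ - y, which changes the first moment by -mass · y. It is
        -- recorded separately because `first` says nothing about vectors of A itself.
        ℓ-a    : ∀ y i → ℓ (linComb F y a) i ≈ - (mass * y i)
        zeroth : ∀ v → Outside v → ∑ᵛ d (λ y → φ (v ⊞A y)) ≈ mass
        first  : ∀ v → Outside v → ∀ i → ∑ᵛ d (λ y → y i * φ (v ⊞A y)) ≈ ℓ v i

    Moments-resp : ∀ {φ ψ} → (∀ x → NonZeroV F x → φ x ≈ ψ x) → Moments φ → Moments ψ
    Moments-resp φ≈ψ M = record
      { mass = mass ; ℓ = ℓ ; ℓ-cong = ℓ-cong ; ℓ-⊞ = ℓ-⊞ ; ℓ-⊠ = ℓ-⊠ ; ℓ-a = ℓ-a
      ; zeroth = λ v out → trans (∑ᵛ-cong d λ y → sym (φ≈ψ _ (out y))) (zeroth v out)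
      ; first  = λ v out i → trans (∑ᵛ-cong d λ y → *-congˡ (sym (φ≈ψ _ (out y)))) (first v out i)
      }
      where open Moments M

    Moments-0 : ∀ {φ} → (∀ v → ∑ᵛ d (λ y → φ (v ⊞A y)) ≈ 0#) →
      (∀ v i → ∑ᵛ d (λ y → y i * φ (v ⊞A y)) ≈ 0#) → Moments φ
    Moments-0 zeroth≈0 first≈0 = record
      { mass = 0# ; ℓ = λ _ _ → 0# ; ℓ-cong = λ _ _ → refl
      ; ℓ-⊞ = λ _ _ _ → sym (+-identityˡ 0#) ; ℓ-⊠ = λ c _ _ → sym (zeroʳ c)
      ; ℓ-a = λ y i → solve 1 (λ y → con (+ 0) := :- (con (+ 0) :* y)) refl (y i)
      ; zeroth = λ v _ → zeroth≈0 v ; first = λ v _ → first≈0 v }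

    Moments-+* : ∀ {φ ψ} c → Moments φ → Moments ψ → Moments (λ x → c * φ x + ψ x)
    Moments-+* {φ} {ψ} c M N = record
      { mass = c * M.mass + N.mass
      ; ℓ = λ v i → c * M.ℓ v i + N.ℓ v i
      ; ℓ-cong = λ eq i → +-cong (*-congˡ (M.ℓ-cong eq i)) (N.ℓ-cong eq i)
      ; ℓ-⊞ = λ v w i → trans (+-cong (*-congˡ (M.ℓ-⊞ v w i)) (N.ℓ-⊞ v w i))
          (solve 5 (λ c a b d e → c :* (a :+ b) :+ (d :+ e) := (c :* a :+ d) :+ (c :* b :+ e)) refl
            c (M.ℓ v i) (M.ℓ w i) (N.ℓ v i) (N.ℓ w i))
      ; ℓ-⊠ = λ b v i → trans (+-cong (*-congˡ (M.ℓ-⊠ b v i)) (N.ℓ-⊠ b v i))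
          (solve 4 (λ c b x y → c :* (b :* x) :+ b :* y := b :* (c :* x :+ y)) refl c b (M.ℓ v i) (N.ℓ v i))
      ; ℓ-a = λ y i → trans (+-cong (*-congˡ (M.ℓ-a y i)) (N.ℓ-a y i))
          (solve 4 (λ c m n y → c :* (:- (m :* y)) :+ (:- (n :* y)) := :- ((c :* m :+ n) :* y)) refl
            c M.mass N.mass (y i))
      ; zeroth = λ v out → begin
          ∑ᵛ d (λ y → c * φ (v ⊞A y) + ψ (v ⊞A y))                      ≈⟨ ∑ᵛ-+ d _ _ ⟩
          ∑ᵛ d (λ y → c * φ (v ⊞A y)) + ∑ᵛ d (λ y → ψ (v ⊞A y))         ≈⟨ +-cong (∑ᵛ-* d c _) (N.zeroth v out) ⟩
          c * ∑ᵛ d (λ y → φ (v ⊞A y)) + N.mass                          ≈⟨ +-congʳ (*-congˡ (M.zeroth v out)) ⟩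
          c * M.mass + N.mass                                           ∎
      ; first = λ v out i → begin
          ∑ᵛ d (λ y → y i * (c * φ (v ⊞A y) + ψ (v ⊞A y)))
            ≈⟨ ∑ᵛ-cong d (λ y → solve 4 (λ y c f g → y :* (c :* f :+ g) := c :* (y :* f) :+ y :* g) refl
                 (y i) c (φ (v ⊞A y)) (ψ (v ⊞A y))) ⟩
          ∑ᵛ d (λ y → c * (y i * φ (v ⊞A y)) + y i * ψ (v ⊞A y))
            ≈⟨ ∑ᵛ-+ d _ _ ⟩
          ∑ᵛ d (λ y → c * (y i * φ (v ⊞A y))) + ∑ᵛ d (λ y → y i * ψ (v ⊞A y))
            ≈⟨ +-cong (trans (∑ᵛ-* d c _) (*-congˡ (M.first v out i))) (N.first v out i) ⟩
          c * M.ℓ v i + N.ℓ v i ∎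
      }
      where
      module M = Moments M
      module N = Moments N

    module _ {k} (d+k≡n : d ℕ.+ k ≡ n) (S : Subspace F k n) where
      open Subspace S renaming (basis to s)

      InSub-resp : ∀ {x y} → x ≋ y → InSub F S x → InSub F S y
      InSub-resp x≋y (α , x≋α) = α , λ j → trans (sym (x≋y j)) (x≋α j)

      InSub? : ∀ x → Dec (InSub F S x)
      InSub? x = Finite.search (Tuple-finite (suc k))
        (λ α≋β x≋α j → trans (x≋α j) (·-cong s α≋β j)) (λ α → x ≋? linComb F α s)

      -- A decided version of the incidence vector. A given χ is not assumed to respect `≈` and is
      -- arbitrary at 0; this one respects `≈` everywhere, and agrees with χ at nonzero vectors.
      indicator : Vector F n → Carrier
      indicator x with InSub? x
      ... | yes _ = 1#
      ... | no  _ = 0#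

      indicator-∈ : ∀ {x} → InSub F S x → indicator x ≈ 1#
      indicator-∈ {x} x∈S with InSub? x
      ... | yes _  = refl
      ... | no x∉S = ⊥-elim (x∉S x∈S)

      indicator-∉ : ∀ {x} → ¬ InSub F S x → indicator x ≈ 0#
      indicator-∉ {x} x∉S with InSub? x
      ... | yes x∈S = ⊥-elim (x∉S x∈S)
      ... | no  _   = refl

      indicator-iff : ∀ {x y} → (InSub F S x → InSub F S y) → (InSub F S y → InSub F S x) →
                      indicator x ≈ indicator y
      indicator-iff {x} {y} to from with InSub? y
      ... | yes y∈S = indicator-∈ (from y∈S)
      ... | no  y∉S = indicator-∉ (y∉S ∘ to)

      indicator-cong : ∀ {x y} → x ≋ y → indicator x ≈ indicator y
      indicator-cong x≋y = indicator-iff (InSub-resp x≋y) (InSub-resp (λ j → sym (x≋y j)))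

      slice-cong : ∀ v → Congruent (λ y → indicator (v ⊞A y))
      slice-cong v eq = indicator-cong λ j → +-congˡ (·-cong a eq j)

      -- Linear dependence of `a` counts too, because 0 lies in S. The negation therefore says both
      -- that `a` is independent and that A meets S only in 0.
      Secant : Set
      Secant = ∃ λ (t : Tuple d) → ¬ (∀ i → t i ≈ 0#) × InSub F S (linComb F t a)

      secant? : Dec Secant
      secant? = Finite.search (Tuple-finite d)
        (λ t≋t′ (t≉0 , t∈S) → (λ t′≈0 → t≉0 λ i → trans (t≋t′ i) (t′≈0 i)) ,
                               InSub-resp (·-cong a t≋t′) t∈S)
        (λ t → ¬? (t ≋? λ _ → 0#) ×-dec InSub? (linComb F t a))

      -- Translation by t · a preserves S, so `coset-sum` applies along t: with the constant weight
      -- 1 (τ = 0) for the zeroth moment, and with the weight y i (τ = t i) for the first.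
      Moments-secant : Secant → Moments indicator
      Moments-secant (t , t≉0 , α , ta≋αs) = Moments-0
        (λ v → trans (∑ᵛ-cong d λ y → sym (*-identityˡ _))
          (coset-sum μ≉0 μ≉1 d (slice-cong v) (λ _ → refl) t 0# t≉0 (invariant v)
            (λ c y → sym (trans (+-congˡ (zeroʳ c)) (+-identityʳ 1#)))))
        (λ v i → coset-sum μ≉0 μ≉1 d (slice-cong v) (λ eq → eq i) t (t i) t≉0 (invariant v) (λ c y → refl))
        where
        translate : ∀ v c y j → (v ⊞A (y ⊞ c ⊠ t)) j ≈ (v ⊞A y) j + c * α · s [ j ]
        translate v c y j = begin
          v j + (y ⊞ c ⊠ t) · a [ j ]                 ≈⟨ +-congˡ (·-+ y (c ⊠ t) a j) ⟩
          v j + (y · a [ j ] + (c ⊠ t) · a [ j ])     ≈⟨ +-congˡ (+-congˡ (·-* c t a j)) ⟩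
          v j + (y · a [ j ] + c * t · a [ j ])       ≈⟨ +-assoc _ _ _ ⟨
          v j + y · a [ j ] + c * t · a [ j ]         ≈⟨ +-congˡ (*-congˡ (ta≋αs j)) ⟩
          v j + y · a [ j ] + c * α · s [ j ]         ∎
        invariant : ∀ v c y → indicator (v ⊞A (y ⊞ c ⊠ t)) ≈ indicator (v ⊞A y)
        invariant v c y = indicator-iff
          (λ (β , eq) → (λ i → β i - c * α i) , λ j → begin
            (v ⊞A y) j                                               ≈⟨ solve 2 (λ x z → x := x :+ z :- z) refl _ _ ⟩
            (v ⊞A y) j + c * α · s [ j ] - c * α · s [ j ]           ≈⟨ +-congʳ (translate v c y j) ⟨
            (v ⊞A (y ⊞ c ⊠ t)) j - c * α · s [ j ]                   ≈⟨ +-cong (eq j) (-‿cong (sym (·-* c α s j))) ⟩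
            β · s [ j ] - (c ⊠ α) · s [ j ]                          ≈⟨ ·-- β (c ⊠ α) s j ⟨
            (λ i → β i - c * α i) · s [ j ]                          ∎)
          (λ (β , eq) → (β ⊞ c ⊠ α) , λ j → begin
            (v ⊞A (y ⊞ c ⊠ t)) j                 ≈⟨ translate v c y j ⟩
            (v ⊞A y) j + c * α · s [ j ]         ≈⟨ +-cong (eq j) (sym (·-* c α s j)) ⟩
            β · s [ j ] + (c ⊠ α) · s [ j ]      ≈⟨ ·-+ β (c ⊠ α) s j ⟨
            (β ⊞ c ⊠ α) · s [ j ]                ∎)

      module Transversal (¬secant : ¬ Secant) where

        y-unique : ∀ {y y′ α α′} →
          (∀ j → y · a [ j ] + α · s [ j ] ≈ y′ · a [ j ] + α′ · s [ j ]) → y ≋ y′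
        y-unique {y} {y′} {α} {α′} eq = decidable-stable (y ≋? y′) λ y≉y′ → ¬secant
          ( (λ i → y i - y′ i)
          , (λ eq₀ → y≉y′ λ i → x-y≈0⇒x≈y (eq₀ i))
          , (λ i → α′ i - α i)
          , λ j → begin
              (λ i → y i - y′ i) · a [ j ]
                ≈⟨ ·-- y y′ a j ⟩
              y · a [ j ] - y′ · a [ j ]
                ≈⟨ solve 3 (λ y α y′ → y :- y′ := (y :+ α) :- (y′ :+ α)) refl _ (α · s [ j ]) _ ⟩
              (y · a [ j ] + α · s [ j ]) - (y′ · a [ j ] + α · s [ j ])
                ≈⟨ +-congʳ (eq j) ⟩
              (y′ · a [ j ] + α′ · s [ j ]) - (y′ · a [ j ] + α · s [ j ])
                ≈⟨ solve 3 (λ y′ α′ α → (y′ :+ α′) :- (y′ :+ α) := α′ :- α) refl _ _ _ ⟩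
              α′ · s [ j ] - α · s [ j ]
                ≈⟨ ·-- α′ α s j ⟨
              (λ i → α′ i - α i) · s [ j ] ∎ )

        combination : Tuple d × Tuple (suc k) → Vector F n
        combination (y , α) j = y · a [ j ] + α · s [ j ]

        combination-injective : ∀ x x′ → combination x ≋ combination x′ →
          (proj₁ x ≋ proj₁ x′) × (proj₂ x ≋ proj₂ x′)
        combination-injective (y , α) (y′ , α′) eq = y≋y′ , λ i → x-y≈0⇒x≈y (independent (λ i → α i - α′ i) (λ j → begin
          (λ i → α i - α′ i) · s [ j ]
            ≈⟨ ·-- α α′ s j ⟩
          α · s [ j ] - α′ · s [ j ]
            ≈⟨ solve 3 (λ y α α′ → α :- α′ := (y :+ α) :- (y :+ α′)) refl (y · a [ j ]) _ _ ⟩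
          (y · a [ j ] + α · s [ j ]) - (y · a [ j ] + α′ · s [ j ])
            ≈⟨ x≈y⇒x-y≈0 (trans (eq j) (+-congʳ (sym (·-cong a y≋y′ j)))) ⟩
          0# ∎) i)
          where
          y≋y′ : y ≋ y′
          y≋y′ = y-unique {y} {y′} {α} {α′} eq

        -- A ⊕ S = V without dimension theory: the sum map is injective and q^d · q^(k+1) = q^(n+1).
        decompose : ∀ v → ∃ λ x → combination x ≋ v
        decompose = injective⇒surjective (×-finite (Tuple-finite d) (Tuple-finite (suc k))) (Tuple-finite (suc n))
          (ℕₚ.≤-reflexive (≡.trans (≡.cong (q ℕ.^_) (≡.trans (≡.cong suc (≡.sym d+k≡n)) (≡.sym (ℕₚ.+-suc d k))))
            (ℕₚ.^-distribˡ-+-* q d (suc k))))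
          combination (λ (y≋ , α≋) j → +-cong (·-cong a y≋ j) (·-cong s α≋ j)) combination-injective

        y-of : Vector F n → Tuple d
        y-of v = proj₁ (proj₁ (decompose v))

        α-of : Vector F n → Tuple (suc k)
        α-of v = proj₂ (proj₁ (decompose v))

        decomposed : ∀ v j → y-of v · a [ j ] + α-of v · s [ j ] ≈ v j
        decomposed v = proj₂ (decompose v)

        y-of-unique : ∀ {v y α} → (∀ j → v j ≈ y · a [ j ] + α · s [ j ]) → y-of v ≋ y
        y-of-unique {v} {y} {α} eq = y-unique {y-of v} {y} {α-of v} {α} (λ j → trans (decomposed v j) (eq j))

        -- The coset v + A meets S in exactly one vector, found by subtracting the A-component of v.
        -- Both moment sums then have a single nonvanishing point, which makes `neg` the functional
        -- ℓ, with mass 1.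
        neg : Vector F n → Tuple d
        neg v i = - y-of v i

        neg-∈ : ∀ v → InSub F S (v ⊞A neg v)
        neg-∈ v = α-of v , λ j → begin
          v j + neg v · a [ j ]
            ≈⟨ +-cong (sym (decomposed v j)) (trans (·-cong a (λ i → solve 1 (λ y → :- y := con (+ 0) :- y) refl (y-of v i)) j)
                 (trans (·-- (λ _ → 0#) (y-of v) a j) (+-congʳ (·-0 a (λ _ → refl) j)))) ⟩
          y-of v · a [ j ] + α-of v · s [ j ] + (0# - y-of v · a [ j ])
            ≈⟨ solve 2 (λ y α → y :+ α :+ (con (+ 0) :- y) := α) refl _ _ ⟩
          α-of v · s [ j ] ∎

        neg-unique : ∀ v y → InSub F S (v ⊞A y) → y ≋ neg v
        neg-unique v y (α , eq) i = begin
          y i                                 ≈⟨ solve 1 (λ y → y := :- (con (+ 0) :- y)) refl (y i) ⟩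
          - (0# - y i)                        ≈⟨ -‿cong (y-of-unique {v} {λ i → 0# - y i} {α} (λ j → begin
            v j
              ≈⟨ solve 2 (λ v y → v := con (+ 0) :- y :+ (v :+ y)) refl (v j) (y · a [ j ]) ⟩
            0# - y · a [ j ] + (v ⊞A y) j
              ≈⟨ +-cong (sym (trans (·-- (λ _ → 0#) y a j) (+-congʳ (·-0 a (λ _ → refl) j)))) (eq j) ⟩
            (λ i → 0# - y i) · a [ j ] + α · s [ j ] ∎) i) ⟨
          - y-of v i ∎

        moments : Moments indicator
        moments = record
          { mass = 1#
          ; ℓ = neg
          ; ℓ-cong = λ {v} {w} eq i → -‿cong (y-of-unique {v} {y-of w} {α-of w} (λ j → trans (eq j) (sym (decomposed w j))) i)
          ; ℓ-⊞ = λ v w i → trans (-‿cong (y-of-unique {v ⊞ w} {y-of v ⊞ y-of w} {α-of v ⊞ α-of w} (λ j → begin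
              v j + w j
                ≈⟨ +-cong (decomposed v j) (decomposed w j) ⟨
              (y-of v · a [ j ] + α-of v · s [ j ]) + (y-of w · a [ j ] + α-of w · s [ j ])
                ≈⟨ solve 4 (λ a b c d → (a :+ b) :+ (c :+ d) := (a :+ c) :+ (b :+ d)) refl _ _ _ _ ⟩
              (y-of v · a [ j ] + y-of w · a [ j ]) + (α-of v · s [ j ] + α-of w · s [ j ])
                ≈⟨ +-cong (·-+ (y-of v) (y-of w) a j) (·-+ (α-of v) (α-of w) s j) ⟨
              (y-of v ⊞ y-of w) · a [ j ] + (α-of v ⊞ α-of w) · s [ j ] ∎) i))
              (solve 2 (λ x y → :- (x :+ y) := :- x :+ :- y) refl (y-of v i) (y-of w i))
          ; ℓ-⊠ = λ c v i → trans (-‿cong (y-of-unique {c ⊠ v} {c ⊠ y-of v} {c ⊠ α-of v} (λ j → begin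
              c * v j
                ≈⟨ *-congˡ (decomposed v j) ⟨
              c * (y-of v · a [ j ] + α-of v · s [ j ])
                ≈⟨ distribˡ c _ _ ⟩
              c * y-of v · a [ j ] + c * α-of v · s [ j ]
                ≈⟨ +-cong (·-* c (y-of v) a j) (·-* c (α-of v) s j) ⟨
              (c ⊠ y-of v) · a [ j ] + (c ⊠ α-of v) · s [ j ] ∎) i))
              (solve 2 (λ c x → :- (c :* x) := c :* :- x) refl c (y-of v i))
          ; ℓ-a = λ y i → -‿cong (trans (y-of-unique {linComb F y a} {y} {λ _ → 0#} (λ j → begin
              y · a [ j ]                               ≈⟨ +-identityʳ _ ⟨
              y · a [ j ] + 0#                          ≈⟨ +-congˡ (·-0 s (λ _ → refl) j) ⟨
              y · a [ j ] + (λ _ → 0#) · s [ j ]        ∎) i) (sym (*-identityˡ (y i))))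
          ; zeroth = λ v _ → trans (∑ᵛ-point d (slice-cong v) (neg v)
              (λ y y≉ → indicator-∉ (y≉ ∘ neg-unique v y))) (indicator-∈ (neg-∈ v))
          ; first = λ v _ i → trans (∑ᵛ-point d (λ eq → *-cong (eq i) (slice-cong v eq)) (neg v)
              (λ y y≉ → trans (*-congˡ (indicator-∉ (y≉ ∘ neg-unique v y))) (zeroʳ (y i))))
              (trans (*-congˡ (indicator-∈ (neg-∈ v))) (*-identityʳ _))
          }

      Moments-subspace : Moments indicator
      Moments-subspace with secant?
      ... | yes secant  = Moments-secant secant
      ... | no  ¬secant = Transversal.moments ¬secant

      Moments-incidence : ∀ {χ} → IsIncidenceVector F n (InSub F S) χ → Moments (λ x → ι (χ x))
      Moments-incidence {χ} isInc = Moments-resp agree Moments-subspace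
        where
        agree : ∀ x → NonZeroV F x → indicator x ≈ ι (χ x)
        agree x x≉0 with InSub? x
        ... | yes x∈S = sym (trans (reflexive (≡.cong ι (proj₁ (isInc x x≉0) x∈S))) (+-identityʳ 1#))
        ... | no  x∉S = sym (reflexive (≡.cong ι (proj₂ (isInc x x≉0) x∉S)))

    Moments-sum : ∀ {k} → d ℕ.+ k ≡ n → ∀ m (S : Fin m → Subspace F k n) (χ : Fin m → Vector F n → ℕ) →
      (∀ i → IsIncidenceVector F n (InSub F (S i)) (χ i)) → ∀ (c : Fin m → ℕ) →
      Moments (λ x → ι (∑ℕ m (λ i → c i ℕ.* χ i x)))
    Moments-sum d+k≡n zero    S χ isInc c = Moments-0
      (λ _ → ∑ᵛ-zero d λ _ → refl) (λ _ i → ∑ᵛ-zero d λ y → zeroʳ (y i))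
    Moments-sum d+k≡n (suc m) S χ isInc c = Moments-resp
      (λ x _ → sym (trans (ι-+ (c zero ℕ.* χ zero x) _) (+-congʳ (ι-* (c zero) (χ zero x)))))
      (Moments-+* (ι (c zero)) (Moments-incidence d+k≡n (S zero) (isInc zero))
        (Moments-sum d+k≡n m (S ∘ suc) (χ ∘ suc) (isInc ∘ suc) (c ∘ suc)))

    Moments-code : ∀ {k} → d ℕ.+ k ≡ n → ∀ {f} → InCode F p k n f → Moments (λ x → ι (f x))
    Moments-code d+k≡n (m , S , χ , isInc , c , f≡) = Moments-resp
      (λ x x≉0 → sym (ι-mod (f≡ x x≉0))) (Moments-sum d+k≡n m S χ isInc c)
      where
      ι-mod : ∀ {a b} → a ≡[mod p ] b → ι a ≈ ι b
      ι-mod {a} {b} (s , t , eq) = begin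
        ι a                       ≈⟨ +-identityʳ _ ⟨
        ι a + 0#                  ≈⟨ +-congˡ (ι-multiple s) ⟨
        ι a + ι (s ℕ.* p)         ≈⟨ ι-+ a _ ⟨
        ι (a ℕ.+ s ℕ.* p)         ≡⟨ ≡.cong ι eq ⟩
        ι (b ℕ.+ t ℕ.* p)         ≈⟨ ι-+ b _ ⟩
        ι b + ι (t ℕ.* p)         ≈⟨ +-congˡ (ι-multiple t) ⟩
        ι b + 0#                  ≈⟨ +-identityʳ _ ⟩
        ι b                       ∎

-- 𝔽ₚ-subspaces of F.

module PrimeSubspaces (F : CommutativeRing 0ℓ 0ℓ) (isField : IsField F)
  (p h : ℕ) (p-prime : Prime p) (hasSize : HasSize F (p ℕ.^ h)) where
  open CommutativeRing F hiding (zero)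
  open FieldProperties F isField
  open FiniteFieldProperties F isField p h p-prime hasSize
  open IntegerSolver F
  open SetoidReasoning setoid

  Span : List Carrier → Carrier → Set
  Span []       x = x ≈ 0#
  Span (w ∷ ws) x = Σ (Fin p) λ c → Span ws (x - ι (toℕ c) * w)

  Span-resp : ∀ ws {x y} → x ≈ y → Span ws x → Span ws y
  Span-resp []       x≈y x≈0     = trans (sym x≈y) x≈0
  Span-resp (w ∷ ws) x≈y (c , s) = c , Span-resp ws (+-congʳ x≈y) s

  Span? : ∀ ws x → Dec (Span ws x)
  Span? []       x = x ≟ 0#
  Span? (w ∷ ws) x = Finₚ.any? λ c → Span? ws (x - ι (toℕ c) * w)

  Span-cons : ∀ {w} ws {x c} → 𝔽ₚ c → Span ws (x - c * w) → Span (w ∷ ws) x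
  Span-cons ws (i , c≈i) s = i , Span-resp ws (+-congˡ (-‿cong (*-congʳ c≈i))) s

  Span-+ : ∀ ws {x y} → Span ws x → Span ws y → Span ws (x + y)
  Span-+ []       x≈0 y≈0 = trans (+-cong x≈0 y≈0) (+-identityˡ 0#)
  Span-+ (w ∷ ws) {x} {y} (i , s) (j , t) = Span-cons ws (𝔽ₚ-+ (𝔽ₚ-ι (toℕ i)) (𝔽ₚ-ι (toℕ j)))
    (Span-resp ws (solve 5 (λ x y i j w → (x :- i :* w) :+ (y :- j :* w) := (x :+ y) :- (i :+ j) :* w)
      refl x y _ _ w) (Span-+ ws s t))

  Span-* : ∀ ws {c x} → 𝔽ₚ c → Span ws x → Span ws (c * x)
  Span-* []       {c} c∈ x≈0 = trans (*-congˡ x≈0) (zeroʳ c)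
  Span-* (w ∷ ws) {c} {x} c∈ (i , s) = Span-cons ws (𝔽ₚ-* c∈ (𝔽ₚ-ι (toℕ i)))
    (Span-resp ws (solve 4 (λ c x i w → c :* (x :- i :* w) := c :* x :- c :* i :* w) refl c x _ w)
      (Span-* ws c∈ s))

  Span-- : ∀ ws {x y} → Span ws x → Span ws y → Span ws (x - y)
  Span-- ws {x} {y} s t = Span-+ ws s (Span-resp ws (solve 1 (λ y → :- con (+ 1) :* y := :- y) refl y)
    (Span-* ws (𝔽ₚ-neg 𝔽ₚ-1) t))

  Span-0 : ∀ ws → Span ws 0#
  Span-0 []       = refl
  Span-0 (w ∷ ws) = Span-cons ws 𝔽ₚ-0
    (Span-resp ws (solve 1 (λ w → con (+ 0) := con (+ 0) :- con (+ 0) :* w) refl w) (Span-0 ws))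

  Span-weaken : ∀ {w} ws {x} → Span ws x → Span (w ∷ ws) x
  Span-weaken {w} ws {x} s = Span-cons ws 𝔽ₚ-0
    (Span-resp ws (solve 2 (λ x w → x := x :- con (+ 0) :* w) refl x w) s)

  Span-head : ∀ {w} ws → Span (w ∷ ws) w
  Span-head {w} ws = Span-cons ws 𝔽ₚ-1
    (Span-resp ws (solve 1 (λ w → con (+ 0) := w :- con (+ 1) :* w) refl w) (Span-0 ws))

  Span-cancel : ∀ ws {c x} → 𝔽ₚ c → ¬ (c ≈ 0#) → Span ws (c * x) → Span ws x
  Span-cancel ws {c} {x} c∈ c≉0 s with b , b∈ , cb≈1 ← 𝔽ₚ-inverse c∈ c≉0 = Span-resp ws (begin
    b * (c * x)    ≈⟨ solve 3 (λ b c x → b :* (c :* x) := c :* b :* x) refl b c x ⟩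
    c * b * x      ≈⟨ *-congʳ cb≈1 ⟩
    1# * x         ≈⟨ *-identityˡ x ⟩
    x              ∎) (Span-* ws b∈ s)

  -- Each f i is adjoined unless that would bring s into the span. A refused f i satisfies s = c · f
  -- i + w with w in the span; here c ≠ 0, as s is not in the span, so solving for f i places it in
  -- the span plus 𝔽ₚ s.
  greedy : ∀ {s} → ¬ (s ≈ 0#) → ∀ m (f : Fin m → Carrier) → ∃ λ ws → ¬ Span ws s ×
    (∀ i → ∃ λ c → 𝔽ₚ c × Span ws (f i - c * s))
  greedy s≉0 zero    f = [] , s≉0 , λ ()
  greedy {s} s≉0 (suc m) f with ws , s∉ , complement ← greedy s≉0 m (f ∘ suc) | Span? (f zero ∷ ws) s
  ... | no  s∉′ = f zero ∷ ws , s∉′ , λ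
        { zero    → 0# , 𝔽ₚ-0 , Span-resp (f zero ∷ ws)
                      (solve 2 (λ x s → x := x :- con (+ 0) :* s) refl (f zero) s) (Span-head ws)
        ; (suc i) → let c , c∈ , t = complement i in c , c∈ , Span-weaken ws t }
  ... | yes (i , t) = ws , s∉ , λ
        { zero    → head-case (ι (toℕ i)) (𝔽ₚ-ι (toℕ i)) t
        ; (suc j) → complement j }
    where
    head-case : ∀ c → 𝔽ₚ c → Span ws (s - c * f zero) → ∃ λ b → 𝔽ₚ b × Span ws (f zero - b * s)
    head-case c c∈ t with c ≟ 0#
    ... | yes c≈0 = ⊥-elim (s∉ (Span-resp ws (begin
            s - c * f zero      ≈⟨ +-congˡ (-‿cong (*-congʳ c≈0)) ⟩
            s - 0# * f zero     ≈⟨ solve 2 (λ s x → s :- con (+ 0) :* x := s) refl s (f zero) ⟩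
            s                   ∎) t))
    ... | no  c≉0 with b , b∈ , cb≈1 ← 𝔽ₚ-inverse c∈ c≉0 = b , b∈ , Span-resp ws (begin
            - b * (s - c * f zero)       ≈⟨ solve 4 (λ b s c x → :- b :* (s :- c :* x) := c :* b :* x :- b :* s)
                                              refl b s c (f zero) ⟩
            c * b * f zero - b * s       ≈⟨ +-congʳ (trans (*-congʳ cb≈1) (*-identityˡ _)) ⟩
            f zero - b * s               ∎) (Span-* ws (𝔽ₚ-neg b∈) t)

  abstract
    -- Running `greedy` through all of F yields a complement of 𝔽ₚ s. It is the kernel of an
    -- 𝔽ₚ-functional F → 𝔽ₚ with value 1 at s, by which an F-valued map on U can cut out an
    -- 𝔽ₚ-hyperplane of U.
    hyperplane-avoiding : ∀ s → ¬ (s ≈ 0#) → ∃ λ ws → ¬ Span ws s ×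
      (∀ x → ∃ λ c → 𝔽ₚ c × Span ws (x - c * s))
    hyperplane-avoiding s s≉0 with ws , s∉ , complement ← greedy s≉0 q (Finite.element F-finite) =
      ws , s∉ , λ x → let c , c∈ , t = complement (index x) in
        c , c∈ , Span-resp ws (+-congʳ (element-index x)) t

-- The linear set of U modulo A: covering, tangent vectors, and a basis inside U.

module LinearSets (F : CommutativeRing 0ℓ 0ℓ) (isField : IsField F)
  (p h : ℕ) (p-prime : Prime p) (hasSize : HasSize F (p ℕ.^ h)) where
  open CommutativeRing F hiding (zero)
  open IsField isField
  open FieldProperties F isField
  open FiniteFieldProperties F isField p h p-prime hasSize
  open VectorSums F isField p h p-prime hasSize
  open PrimeSubspaces F isField p h p-prime hasSize
  open IntegerSolver F
  open SetoidReasoning setoid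

  𝔽ₚ-Tuple : ∀ {m} → Tuple m → Set
  𝔽ₚ-Tuple x = ∀ i → 𝔽ₚ (x i)

  -- Counting and searching run over digit vectors, algebra over their images in F.
  embed : ∀ {m} → (Fin m → Fin p) → Tuple m
  embed c i = ι (toℕ (c i))

  embed-∈ : ∀ {m} (c : Fin m → Fin p) → 𝔽ₚ-Tuple (embed c)
  embed-∈ c i = 𝔽ₚ-ι (toℕ (c i))

  coordinates : ∀ {m} {x : Tuple m} → 𝔽ₚ-Tuple x → Fin m → Fin p
  coordinates x∈ i = proj₁ (x∈ i)

  embed-coordinates : ∀ {m} {x : Tuple m} (x∈ : 𝔽ₚ-Tuple x) → x ≋ embed (coordinates x∈)
  embed-coordinates x∈ i = proj₂ (x∈ i)

  Coordinates-finite : ∀ m → Finite (≋-setoid (≡.setoid (Fin p)) m) (p ℕ.^ m)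
  Coordinates-finite m = vector-finite m (Fin-finite p)

  fpComb≈· : ∀ {m n} (c : Fin m → Fin p) (u : Fin m → Vector F n) j → fpComb F p c u j ≈ embed c · u [ j ]
  fpComb≈· {zero}  c u j = refl
  fpComb≈· {suc m} c u j = +-cong (natMul≈ι* (toℕ (c zero)) (u zero j)) (fpComb≈· (c ∘ suc) (u ∘ suc) j)

  module _ {n D : ℕ} (u : Fin D → Vector F n) where

    -- No nonzero vector of U = ⟨u⟩ over 𝔽ₚ lies in A = ⟨a⟩, and both families
    -- are independent over their fields of scalars.
    Skew : ∀ {d} → (Fin d → Vector F n) → Set
    Skew {d} a = ∀ (y : Tuple d) (x : Tuple D) → 𝔽ₚ-Tuple x →
      (∀ j → y · a [ j ] + x · u [ j ] ≈ 0#) → (∀ i → y i ≈ 0#) × (∀ i → x i ≈ 0#)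

    -- The set F × U × A, with U and A given by coordinates. It indexes the vectors l u + y in
    -- `skew-extend`, the vectors l v + u + y in `covering`, and the codes in `NoTangent`.
    Triples-finite : ∀ d → Finite (setoid ×ₛ (≋-setoid (≡.setoid (Fin p)) D ×ₛ ≋-setoid setoid d))
                                  (q ℕ.* (p ℕ.^ D ℕ.* q ℕ.^ d))
    Triples-finite d = ×-finite F-finite (×-finite (Coordinates-finite D) (Tuple-finite d))

    embed-cong : ∀ {c c′ : Fin D → Fin p} → (∀ i → c i ≡ c′ i) → embed c ≋ embed c′
    embed-cong c≡c′ i = reflexive (≡.cong (ι ∘ toℕ) (c≡c′ i))

    skew-injective : ∀ {d} {a : Fin d → Vector F n} → Skew a → ∀ {y y′ x x′} → 𝔽ₚ-Tuple x → 𝔽ₚ-Tuple x′ →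
      (∀ j → y · a [ j ] + x · u [ j ] ≈ y′ · a [ j ] + x′ · u [ j ]) → (y ≋ y′) × (x ≋ x′)
    skew-injective {a = a} skew {y} {y′} {x} {x′} x∈ x′∈ eq =
      let y≈0 , x≈0 = skew (λ i → y i - y′ i) (λ i → x i - x′ i) (λ i → 𝔽ₚ-- (x∈ i) (x′∈ i)) (λ j → begin
            (λ i → y i - y′ i) · a [ j ] + (λ i → x i - x′ i) · u [ j ]
              ≈⟨ +-cong (·-- y y′ a j) (·-- x x′ u j) ⟩
            y · a [ j ] - y′ · a [ j ] + (x · u [ j ] - x′ · u [ j ])
              ≈⟨ solve 4 (λ a b c d → a :- b :+ (c :- d) := (a :+ c) :- (b :+ d)) refl _ _ _ _ ⟩
            (y · a [ j ] + x · u [ j ]) - (y′ · a [ j ] + x′ · u [ j ])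
              ≈⟨ x≈y⇒x-y≈0 (eq j) ⟩
            0# ∎) in
      (λ i → x-y≈0⇒x≈y (y≈0 i)) , (λ i → x-y≈0⇒x≈y (x≈0 i))

    -- A vector v can be adjoined as soon as it avoids F U + A, since a forbidden relation with
    -- nonzero coefficient at v can be solved for v. The bound says that F U + A does not fill V.
    skew-extend : ∀ {d} {a : Fin d → Vector F n} → Skew a → q ℕ.* (p ℕ.^ D ℕ.* q ℕ.^ d) ℕ.< q ℕ.^ suc n →
                  ∃ λ v → Skew (v ∷ᵥ a)
    skew-extend {d} {a} skew small
      with v , missed ← unhit (Triples-finite d) (Tuple-finite (suc n))
             (λ (l , c , y) j → l * embed c · u [ j ] + y · a [ j ])
             (λ (l≈ , c≡ , y≋) j → +-cong (*-cong l≈ (·-cong u (embed-cong c≡) j)) (·-cong a y≋ j)) small =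
      v , skew′ v missed
      where
      skew′ : ∀ v → (∀ ((l , c , y) : Carrier × (Fin D → Fin p) × Tuple d) →
              ¬ (∀ j → l * embed c · u [ j ] + y · a [ j ] ≈ v j)) → Skew (v ∷ᵥ a)
      skew′ v missed y x x∈ eq with y zero ≟ 0#
      ... | yes y₀≈0 =
        let y≈0 , x≈0 = skew (y ∘ suc) x x∈ (λ j → begin
              (y ∘ suc) · a [ j ] + x · u [ j ]
                ≈⟨ solve 3 (λ a x v → a :+ x := con (+ 0) :* v :+ a :+ x) refl _ _ (v j) ⟩
              0# * v j + (y ∘ suc) · a [ j ] + x · u [ j ]
                ≈⟨ +-congʳ (+-congʳ (*-congʳ y₀≈0)) ⟨
              y · (v ∷ᵥ a) [ j ] + x · u [ j ]
                ≈⟨ eq j ⟩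
              0# ∎) in
        (λ { zero → y₀≈0 ; (suc i) → y≈0 i }) , x≈0
      ... | no  y₀≉0 with b , y₀b≈1 ← inverse (y zero) y₀≉0 =
        ⊥-elim (missed (- b , coordinates x∈ , (- b) ⊠ (y ∘ suc)) λ j → begin
          - b * embed (coordinates x∈) · u [ j ] + ((- b) ⊠ (y ∘ suc)) · a [ j ]
            ≈⟨ +-cong (*-congˡ (sym (·-cong u (embed-coordinates x∈) j))) (·-* (- b) (y ∘ suc) a j) ⟩
          - b * x · u [ j ] + - b * (y ∘ suc) · a [ j ]
            ≈⟨ solve 5 (λ b x a y v → :- b :* x :+ :- b :* a := y :* b :* v :- b :* (y :* v :+ a :+ x)) refl
                 b _ _ (y zero) (v j) ⟩
          y zero * b * v j - b * (y · (v ∷ᵥ a) [ j ] + x · u [ j ])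
            ≈⟨ +-cong (*-congʳ y₀b≈1) (-‿cong (*-congˡ (eq j))) ⟩
          1# * v j - b * 0#
            ≈⟨ solve 2 (λ v b → con (+ 1) :* v :- b :* con (+ 0) := v) refl (v j) b ⟩
          v j ∎)

    skew-exists : (∀ x → 𝔽ₚ-Tuple x → (∀ j → x · u [ j ] ≈ 0#) → ∀ i → x i ≈ 0#) →
      ∀ d → (∀ d′ → d′ ℕ.< d → q ℕ.* (p ℕ.^ D ℕ.* q ℕ.^ d′) ℕ.< q ℕ.^ suc n) →
      ∃ λ (a : Fin d → Vector F n) → Skew a
    skew-exists independent zero    small = (λ ()) , λ y x x∈ eq → (λ ()) ,
      independent x x∈ (λ j → trans (sym (+-identityˡ _)) (eq j))
    skew-exists independent (suc d) small
      with a , skew ← skew-exists independent d (λ d′ d′<d → small d′ (ℕₚ.m<n⇒m<1+n d′<d))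
      with v , skew′ ← skew-extend skew (small d (ℕₚ.n<1+n d)) = v ∷ᵥ a , skew′

    module Complement {d} (a : Fin d → Vector F n) (skew : Skew a)
      (size : q ℕ.* (p ℕ.^ D ℕ.* q ℕ.^ d) ≡ q ℕ.^ suc n ℕ.* p) where

      -- Every point of PG(V/A) meets the image of U.
      abstract
        covering : ∀ (v : Vector F n) → ∃ λ l → ∃ λ x → ∃ λ y → 𝔽ₚ-Tuple x ×
                   (∀ j → v j ≈ l * x · u [ j ] + y · a [ j ])
        covering v
          -- There are p times as many triples as vectors, so two values of this map agree. Equal
          -- scalars l, l′ would contradict skewness; otherwise division by l - l′ expresses v.
          with (l , c , y) , (l′ , c′ , y′) , distinct , eq ← collision (Triples-finite d) (Tuple-finite (suc n))
                 (≡.subst (q ℕ.^ suc n ℕ.<_) (≡.sym size)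
                   (ℕₚ.m<m*n (q ℕ.^ suc n) p {{ℕₚ.m^n≢0 q (suc n) {{ℕₚ.m^n≢0 p h {{prime⇒nonZero p-prime}}}}}} (ℕ.nonTrivial⇒n>1 p {{prime⇒nonTrivial p-prime}})))
                 (λ (l , c , y) j → l * v j + (y · a [ j ] + embed c · u [ j ]))
          with l ≟ l′
        ... | yes l≈l′ = ⊥-elim (distinct (l≈l′ ,
              let y≋ , x≋ = skew-injective skew (embed-∈ c) (embed-∈ c′) (λ j → begin
                    y · a [ j ] + embed c · u [ j ]
                      ≈⟨ solve 2 (λ l z → z := l :+ z :- l) refl (l * v j) _ ⟩
                    l * v j + (y · a [ j ] + embed c · u [ j ]) - l * v j
                      ≈⟨ +-cong (eq j) (-‿cong (*-congʳ l≈l′)) ⟩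
                    l′ * v j + (y′ · a [ j ] + embed c′ · u [ j ]) - l′ * v j
                      ≈⟨ solve 2 (λ l z → l :+ z :- l := z) refl (l′ * v j) _ ⟩
                    y′ · a [ j ] + embed c′ · u [ j ] ∎)
              in (λ i → ι-injective (x≋ i)) , y≋))
        ... | no  l≉l′ with m , unit ← inverse (l - l′) (l≉l′ ∘ x-y≈0⇒x≈y) =
          m , (λ i → embed c′ i - embed c i) , m ⊠ (λ i → y′ i - y i) ,
          (λ i → 𝔽ₚ-- (embed-∈ c′ i) (embed-∈ c i)) , λ j → begin
            v j
              ≈⟨ *-identityˡ (v j) ⟨
            1# * v j
              ≈⟨ *-congʳ unit ⟨
            (l - l′) * m * v j
              ≈⟨ solve 6 (λ l l′ m v z z′ → (l :- l′) :* m :* v :=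
                   m :* ((l :* v :+ z) :- (l′ :* v :+ z′) :+ (z′ :- z))) refl l l′ m (v j)
                   (y · a [ j ] + embed c · u [ j ]) (y′ · a [ j ] + embed c′ · u [ j ]) ⟩
            m * ((l * v j + (y · a [ j ] + embed c · u [ j ])) - (l′ * v j + (y′ · a [ j ] + embed c′ · u [ j ]))
                 + ((y′ · a [ j ] + embed c′ · u [ j ]) - (y · a [ j ] + embed c · u [ j ])))
              ≈⟨ *-congˡ (+-congʳ (x≈y⇒x-y≈0 (eq j))) ⟩
            m * (0# + ((y′ · a [ j ] + embed c′ · u [ j ]) - (y · a [ j ] + embed c · u [ j ])))
              ≈⟨ solve 5 (λ m y′ x′ y x → m :* (con (+ 0) :+ ((y′ :+ x′) :- (y :+ x))) :=
                   m :* (x′ :- x) :+ m :* (y′ :- y)) refl m _ _ _ _ ⟩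
            m * (embed c′ · u [ j ] - embed c · u [ j ]) + m * (y′ · a [ j ] - y · a [ j ])
              ≈⟨ +-cong (*-congˡ (·-- (embed c′) (embed c) u j))
                   (trans (·-* m (λ i → y′ i - y i) a j) (*-congˡ (·-- y′ y a j))) ⟨
            m * (λ i → embed c′ i - embed c i) · u [ j ] + (m ⊠ (λ i → y′ i - y i)) · a [ j ] ∎

      -- With u = x · u: modulo A, the F-line of u contains no vectors of U beyond the 𝔽ₚ-multiples
      -- of u. For nonzero x it follows that the coset u + A meets B(U) only in the point of u.
      Tangent : Tuple D → Set
      Tangent x = ∀ l x′ y → 𝔽ₚ-Tuple x′ → (∀ j → l * x · u [ j ] ≈ x′ · u [ j ] + y · a [ j ]) → 𝔽ₚ l

      -- The failure of tangency as a witness from a finite set, so that search decides it.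
      ¬Tangent : Tuple D → Set
      ¬Tangent x = ∃ λ ((l , c , y) : Carrier × (Fin D → Fin p) × Tuple d) →
        ¬ 𝔽ₚ l × (∀ j → l * x · u [ j ] ≈ embed c · u [ j ] + y · a [ j ])

      ¬tangent? : ∀ x → Dec (¬Tangent x)
      ¬tangent? x = Finite.search (Triples-finite d)
        (λ (l≈ , c≡ , y≋) (l∉ , eq) → l∉ ∘ 𝔽ₚ-resp (sym l≈) , λ j →
          trans (*-congʳ (sym l≈)) (trans (eq j) (+-cong (·-cong u (embed-cong c≡) j) (·-cong a y≋ j))))
        (λ (l , c , y) → ¬? (𝔽ₚ? l) ×-dec
          ((λ j → l * x · u [ j ]) ≋? (λ j → embed c · u [ j ] + y · a [ j ])))

      ¬Tangent-resp : ∀ {x x′} → x ≋ x′ → ¬Tangent x → ¬Tangent x′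
      ¬Tangent-resp x≋x′ (lcy , l∉ , eq) = lcy , l∉ , λ j → trans (*-congˡ (sym (·-cong u x≋x′ j))) (eq j)

      ¬¬tangent⇒tangent : ∀ {x} → ¬ ¬Tangent x → Tangent x
      ¬¬tangent⇒tangent ¬¬t l x′ y x′∈ eq = decidable-stable (𝔽ₚ? l) λ l∉ → ¬¬t
        ((l , coordinates x′∈ , y) , l∉ , λ j → trans (eq j) (+-congʳ (·-cong u (embed-coordinates x′∈) j)))

      module _ (g : Tuple D → Carrier) (g-cong : Congruent g)
        (g-linear : ∀ c x x′ → g (c ⊠ x ⊞ x′) ≈ c * g x + g x′) where

        -- If g vanished on all tangent vectors, the 𝔽ₚ-hyperplane U₁ = g⁻¹(K) of U
        -- would meet every F-line spanned by a vector of U, since a non-tangent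
        -- line carries at least two dimensions of U. So U₁ would still cover
        -- PG(V/A), which it is too small to do.
        module NoTangent (x* : Tuple D) (x*∈ : 𝔽ₚ-Tuple x*) (gx*≉0 : ¬ (g x* ≈ 0#))
          (no-tangent : ∀ x → 𝔽ₚ-Tuple x → ¬ (g x ≈ 0#) → ¬Tangent x) where

          s : Carrier
          s = g x*

          ws : List Carrier
          ws = proj₁ (hyperplane-avoiding s gx*≉0)

          K : Carrier → Set
          K = Span ws

          s∉K : ¬ K s
          s∉K = proj₁ (proj₂ (hyperplane-avoiding s gx*≉0))

          component : ∀ z → ∃ λ c → 𝔽ₚ c × K (z - c * s)
          component = proj₂ (proj₂ (hyperplane-avoiding s gx*≉0))

          K-multiple : ∀ {c} → 𝔽ₚ c → K (c * s) → c ≈ 0#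
          K-multiple {c} c∈ cs∈K = decidable-stable (c ≟ 0#) λ c≉0 → s∉K (Span-cancel ws c∈ c≉0 cs∈K)

          -- If g x is not in K, then x is not tangent, so l x ≡ x′ modulo A with l outside 𝔽ₚ and
          -- x′ in U. Modulo K, g x and g x′ are c s and b s; with r = b / c the s-parts cancel in
          -- -r x + x′, which thus lies in U₁ and is congruent to (l - r) x. The factor l - r is
          -- nonzero because r is in 𝔽ₚ.
          U₁-meets : ∀ x → 𝔽ₚ-Tuple x → ∃ λ m → ¬ (m ≈ 0#) × ∃ λ x₁ → ∃ λ y → 𝔽ₚ-Tuple x₁ × K (g x₁) ×
                     (∀ j → m * x · u [ j ] ≈ x₁ · u [ j ] + y · a [ j ])
          U₁-meets x x∈ with Span? ws (g x)
          ... | yes gx∈K = 1# , 1≉0 , x , (λ _ → 0#) , x∈ , gx∈K , λ j →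
                trans (*-identityˡ _) (trans (sym (+-identityʳ _)) (+-congˡ (sym (·-0 a (λ _ → refl) j))))
          ... | no  gx∉K
            with (l , c′ , y) , l∉ , eq ← no-tangent x x∈ (λ gx≈0 → gx∉K (Span-resp ws (sym gx≈0) (Span-0 ws)))
            with c , c∈ , gx-cs∈K ← component (g x)
            with b , b∈ , gx′-bs∈K ← component (g (embed c′))
            with c⁻¹ , c⁻¹∈ , cc⁻¹≈1 ← 𝔽ₚ-inverse c∈ (λ c≈0 → gx∉K (Span-resp ws
                   (trans (+-congˡ (-‿cong (*-congʳ c≈0)))
                     (solve 2 (λ z s → z :- con (+ 0) :* s := z) refl (g x) s)) gx-cs∈K)) =
              l - r , (λ l-r≈0 → l∉ (𝔽ₚ-resp (sym (x-y≈0⇒x≈y l-r≈0)) r∈)) ,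
              (- r ⊠ x) ⊞ embed c′ , y , (λ i → 𝔽ₚ-+ (𝔽ₚ-* (𝔽ₚ-neg r∈) (x∈ i)) (embed-∈ c′ i)) ,
              Span-resp ws (begin
                - r * (g x - c * s) + (g (embed c′) - b * s)
                  ≈⟨ solve 6 (λ b c⁻¹ z c s z′ → :- (b :* c⁻¹) :* (z :- c :* s) :+ (z′ :- b :* s) :=
                       :- (b :* c⁻¹) :* z :+ z′ :+ b :* s :* (c :* c⁻¹ :- con (+ 1))) refl
                       b c⁻¹ (g x) c s (g (embed c′)) ⟩
                - r * g x + g (embed c′) + b * s * (c * c⁻¹ - 1#)
                  ≈⟨ +-congˡ (trans (*-congˡ (x≈y⇒x-y≈0 cc⁻¹≈1)) (zeroʳ _)) ⟩
                - r * g x + g (embed c′) + 0#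
                  ≈⟨ +-identityʳ _ ⟩
                - r * g x + g (embed c′)
                  ≈⟨ g-linear (- r) x (embed c′) ⟨
                g ((- r ⊠ x) ⊞ embed c′) ∎)
                (Span-+ ws (Span-* ws (𝔽ₚ-neg r∈) gx-cs∈K) gx′-bs∈K) ,
              λ j → begin
                (l - r) * x · u [ j ]
                  ≈⟨ solve 3 (λ l r x → (l :- r) :* x := :- r :* x :+ l :* x) refl l r _ ⟩
                - r * x · u [ j ] + l * x · u [ j ]
                  ≈⟨ +-cong (sym (·-* (- r) x u j)) (eq j) ⟩
                (- r ⊠ x) · u [ j ] + (embed c′ · u [ j ] + y · a [ j ])
                  ≈⟨ +-assoc _ _ _ ⟨
                (- r ⊠ x) · u [ j ] + embed c′ · u [ j ] + y · a [ j ]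
                  ≈⟨ +-congʳ (·-+ (- r ⊠ x) (embed c′) u j) ⟨
                ((- r ⊠ x) ⊞ embed c′) · u [ j ] + y · a [ j ] ∎
            where
            r : Carrier
            r = b * c⁻¹
            r∈ : 𝔽ₚ r
            r∈ = 𝔽ₚ-* b∈ c⁻¹∈

          g0≈0 : g (λ _ → 0#) ≈ 0#
          g0≈0 = begin
            g (λ _ → 0#)
              ≈⟨ g-cong (λ i → solve 0 (con (+ 0) := :- con (+ 1) :* con (+ 0) :+ con (+ 0)) refl) ⟩
            g ((- 1# ⊠ λ _ → 0#) ⊞ λ _ → 0#)
              ≈⟨ g-linear (- 1#) (λ _ → 0#) (λ _ → 0#) ⟩
            - 1# * g (λ _ → 0#) + g (λ _ → 0#)
              ≈⟨ solve 1 (λ z → :- con (+ 1) :* z :+ z := con (+ 0)) refl _ ⟩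
            0# ∎

          record Cover (v : Vector F n) : Set where
            field
              l   : Carrier
              x₁  : Tuple D
              y   : Tuple d
              x₁∈ : 𝔽ₚ-Tuple x₁
              gx₁ : K (g x₁)
              eq  : ∀ j → v j ≈ l * x₁ · u [ j ] + y · a [ j ]
              x₁≈0⇒l≈0 : (∀ i → x₁ i ≈ 0#) → l ≈ 0#

          cover : ∀ v → Cover v
          cover v with l , x , y , x∈ , eq ← covering v
            with x ≋? (λ _ → 0#)
          ... | yes x≈0 = record
                { l = 0# ; x₁ = λ _ → 0# ; y = y ; x₁∈ = λ _ → 𝔽ₚ-0
                ; gx₁ = Span-resp ws (sym g0≈0) (Span-0 ws)
                ; eq = λ j → trans (eq j) (+-congʳ (trans (*-congˡ (·-0 u x≈0 j))
                    (trans (zeroʳ l) (sym (zeroˡ _)))))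
                ; x₁≈0⇒l≈0 = λ _ → refl }
          ... | no  x≉0
            with m , m≉0 , x₁ , y₁ , x₁∈ , gx₁ , eq₁ ← U₁-meets x x∈
            with m⁻¹ , mm⁻¹≈1 ← inverse m m≉0 = record
                { l = l * m⁻¹ ; x₁ = x₁ ; y = (l * m⁻¹) ⊠ y₁ ⊞ y ; x₁∈ = x₁∈ ; gx₁ = gx₁
                ; eq = λ j → begin
                    v j
                      ≈⟨ eq j ⟩
                    l * x · u [ j ] + y · a [ j ]
                      ≈⟨ +-congʳ (*-congˡ (trans (*-congʳ mm⁻¹≈1) (*-identityˡ _))) ⟨
                    l * (m * m⁻¹ * x · u [ j ]) + y · a [ j ]
                      ≈⟨ +-congʳ (solve 4 (λ l m k x → l :* (m :* k :* x) := l :* k :* (m :* x)) refl l m m⁻¹ _) ⟩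
                    l * m⁻¹ * (m * x · u [ j ]) + y · a [ j ]
                      ≈⟨ +-congʳ (*-congˡ (eq₁ j)) ⟩
                    l * m⁻¹ * (x₁ · u [ j ] + y₁ · a [ j ]) + y · a [ j ]
                      ≈⟨ solve 4 (λ k x₁ y₁ y → k :* (x₁ :+ y₁) :+ y := k :* x₁ :+ (k :* y₁ :+ y)) refl (l * m⁻¹) _ _ _ ⟩
                    l * m⁻¹ * x₁ · u [ j ] + (l * m⁻¹ * y₁ · a [ j ] + y · a [ j ])
                      ≈⟨ +-congˡ (trans (·-+ ((l * m⁻¹) ⊠ y₁) y a j) (+-congʳ (·-* (l * m⁻¹) y₁ a j))) ⟨
                    l * m⁻¹ * x₁ · u [ j ] + ((l * m⁻¹) ⊠ y₁ ⊞ y) · a [ j ] ∎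
                -- If x₁ were 0, then m x · u, and hence the nonzero vector x · u of U, would lie in
                -- A.
                ; x₁≈0⇒l≈0 = λ x₁≈0 → ⊥-elim (x≉0 (proj₂ (skew (- m⁻¹ ⊠ y₁) x x∈ λ j → begin
                    (- m⁻¹ ⊠ y₁) · a [ j ] + x · u [ j ]
                      ≈⟨ +-cong (·-* (- m⁻¹) y₁ a j) (sym (trans (*-congʳ mm⁻¹≈1) (*-identityˡ _))) ⟩
                    - m⁻¹ * y₁ · a [ j ] + m * m⁻¹ * x · u [ j ]
                      ≈⟨ solve 4 (λ m k y x → :- k :* y :+ m :* k :* x := k :* (m :* x :- y)) refl m m⁻¹ _ _ ⟩
                    m⁻¹ * (m * x · u [ j ] - y₁ · a [ j ])
                      ≈⟨ *-congˡ (+-congʳ (trans (eq₁ j) (trans (+-congʳ (·-0 u x₁≈0 j)) (+-identityˡ _)))) ⟩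
                    m⁻¹ * (y₁ · a [ j ] - y₁ · a [ j ])
                      ≈⟨ trans (*-congˡ (-‿inverseʳ _)) (zeroʳ _) ⟩
                    0# ∎))) }

          module C v = Cover (cover v)

          -- U is the direct sum of U₁ and 𝔽ₚ x*. Adding t x* makes the count one in all of U, so
          -- that U₁ needs neither a basis nor a cardinality of its own.
          lift : ∀ v → Fin p → Tuple D
          lift v t = ι (toℕ t) ⊠ x* ⊞ C.x₁ v

          lift-∈ : ∀ v t → 𝔽ₚ-Tuple (lift v t)
          lift-∈ v t i = 𝔽ₚ-+ (𝔽ₚ-* (𝔽ₚ-ι (toℕ t)) (x*∈ i)) (C.x₁∈ v i)

          code : Vector F n × Fin p → Carrier × (Fin D → Fin p) × Tuple d
          code (v , t) = C.l v , coordinates (lift-∈ v t) , C.y v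

          -- Modulo K, g takes the value t s at the lift, which determines t and then x₁; the
          -- equation of the cover returns v.
          code-injective : ∀ w w′ → Setoid._≈_ (setoid ×ₛ (≋-setoid (≡.setoid (Fin p)) D ×ₛ ≋-setoid setoid d))
                             (code w) (code w′) → (proj₁ w ≋ proj₁ w′) × proj₂ w ≡ proj₂ w′
          code-injective (v , t) (v′ , t′) (l≈ , c≡ , y≋) = v≋ , ι-injective ιt≈
            where
            lift≋ : lift v t ≋ lift v′ t′
            lift≋ i = trans (embed-coordinates (lift-∈ v t) i)
              (trans (embed-cong c≡ i) (sym (embed-coordinates (lift-∈ v′ t′) i)))
            ιt≈ : ι (toℕ t) ≈ ι (toℕ t′)
            ιt≈ = x-y≈0⇒x≈y (K-multiple (𝔽ₚ-- (𝔽ₚ-ι (toℕ t)) (𝔽ₚ-ι (toℕ t′))) (Span-resp ws (begin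
              g (C.x₁ v′) - g (C.x₁ v)
                ≈⟨ solve 5 (λ t s z z′ t′ → z′ :- z := (t :- t′) :* s :+ ((t′ :* s :+ z′) :- (t :* s :+ z))) refl
                     (ι (toℕ t)) s _ _ (ι (toℕ t′)) ⟩
              (ι (toℕ t) - ι (toℕ t′)) * s + ((ι (toℕ t′) * s + g (C.x₁ v′)) - (ι (toℕ t) * s + g (C.x₁ v)))
                ≈⟨ +-congˡ (x≈y⇒x-y≈0 (trans (sym (g-linear _ x* _)) (trans (g-cong (λ i → sym (lift≋ i))) (g-linear _ x* _)))) ⟩
              (ι (toℕ t) - ι (toℕ t′)) * s + 0#
                ≈⟨ +-identityʳ _ ⟩
              (ι (toℕ t) - ι (toℕ t′)) * s ∎) (Span-- ws (C.gx₁ v′) (C.gx₁ v))))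
            x₁≋ : C.x₁ v ≋ C.x₁ v′
            x₁≋ i = begin
              C.x₁ v i
                ≈⟨ solve 2 (λ x z → z := x :+ z :- x) refl (ι (toℕ t) * x* i) _ ⟩
              lift v t i - ι (toℕ t) * x* i
                ≈⟨ +-cong (lift≋ i) (-‿cong (*-congʳ ιt≈)) ⟩
              lift v′ t′ i - ι (toℕ t′) * x* i
                ≈⟨ solve 2 (λ x z → x :+ z :- x := z) refl (ι (toℕ t′) * x* i) _ ⟩
              C.x₁ v′ i ∎
            v≋ : v ≋ v′
            v≋ j = trans (C.eq v j) (trans
              (+-cong (*-cong l≈ (·-cong u x₁≋ j)) (·-cong a y≋ j)) (sym (C.eq v′ j)))

          -- `code` injects V × 𝔽ₚ into an equally large set but misses (1, 0, 0): a zero lift puts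
          -- t s in K, so t = 0 and x₁ = 0, and then l = 0 by the normalisation.
          contradiction : ⊥
          contradiction = injective⇒¬missed (×-finite (Tuple-finite (suc n)) (Fin-finite p)) (Triples-finite d)
            (ℕₚ.≤-reflexive size) code code-injective (1# , coordinates {D} (λ _ → 𝔽ₚ-0) , λ _ → 0#)
            λ (v , t) (l≈1 , c≡ , _) →
              let lift≈0 : ∀ i → lift v t i ≈ 0#
                  lift≈0 i = trans (embed-coordinates (lift-∈ v t) i)
                    (trans (embed-cong c≡ i) (sym (embed-coordinates {D} {λ _ → 0#} (λ _ → 𝔽ₚ-0) i)))
                  ιt≈0 : ι (toℕ t) ≈ 0#
                  ιt≈0 = K-multiple (𝔽ₚ-ι (toℕ t)) (Span-resp ws (begin
                    0# - g (C.x₁ v)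
                      ≈⟨ +-congʳ (trans (sym g0≈0) (g-cong (λ i → sym (lift≈0 i)))) ⟩
                    g (lift v t) - g (C.x₁ v)
                      ≈⟨ +-congʳ (g-linear (ι (toℕ t)) x* (C.x₁ v)) ⟩
                    ι (toℕ t) * s + g (C.x₁ v) - g (C.x₁ v)
                      ≈⟨ solve 2 (λ z y → z :+ y :- y := z) refl _ _ ⟩
                    ι (toℕ t) * s ∎) (Span-- ws (Span-0 ws) (C.gx₁ v)))
              in 0≉1 (trans (sym (C.x₁≈0⇒l≈0 v (λ i → trans (sym (trans (+-congʳ (trans (*-congʳ ιt≈0) (zeroˡ _))) (+-identityˡ _))) (lift≈0 i)))) l≈1)

        -- Tangent vectors detect every nonzero g. Taking g to be a coordinate shows that a nonzero
        -- tangent vector exists; taking a component of ℓ shows that ℓ vanishes on U.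
        tangent-exists : ∀ x* → 𝔽ₚ-Tuple x* → ¬ (g x* ≈ 0#) → ∃ λ x → 𝔽ₚ-Tuple x × ¬ (g x ≈ 0#) × Tangent x
        tangent-exists x* x*∈ gx*≉0
          with Finite.search (Coordinates-finite D)
                 (λ c≡ (g≉0 , ¬t) → g≉0 ∘ trans (g-cong (embed-cong c≡)) ,
                                    ¬t ∘ ¬Tangent-resp (λ i → sym (embed-cong c≡ i)))
                 (λ c → ¬? (g (embed c) ≟ 0#) ×-dec ¬? (¬tangent? (embed c)))
        ... | yes (c , g≉0 , ¬t) = embed c , embed-∈ c , g≉0 , ¬¬tangent⇒tangent ¬t
        ... | no  none = ⊥-elim (NoTangent.contradiction x* x*∈ gx*≉0 λ x x∈ gx≉0 →
              decidable-stable (¬tangent? x) λ ¬t → none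
                ( coordinates x∈
                , gx≉0 ∘ trans (g-cong (embed-coordinates x∈))
                , ¬t ∘ ¬Tangent-resp (λ i → sym (embed-coordinates x∈ i)) ))

      -- While A and the vectors found so far do not span V, some v lies outside their span. By
      -- `covering`, v = l u + y with u in U and y in A, so u lies outside as well and can be
      -- adjoined.
      spanning-family : 1 ℕ.< q → ∀ m → d ℕ.+ m ℕ.≤ suc n → ∃ λ (w : Fin m → Vector F n) →
        (∀ i → ∃ λ x → 𝔽ₚ-Tuple x × w i ≋ linComb F x u) ×
        (∀ (y : Tuple d) (α : Tuple m) → (∀ j → y · a [ j ] + α · w [ j ] ≈ 0#) →
          ∀ i → α i ≈ 0#)
      spanning-family 1<q zero    _ = (λ ()) , (λ ()) , λ _ _ _ ()
      spanning-family 1<q (suc m) d+m≤n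
        with w , w∈U , w-independent ← spanning-family 1<q m (ℕₚ.≤-trans (ℕₚ.+-monoʳ-≤ d (ℕₚ.n≤1+n m)) d+m≤n)
        with v , missed ← unhit (×-finite (Tuple-finite d) (Tuple-finite m)) (Tuple-finite (suc n))
               (λ (y , α) j → y · a [ j ] + α · w [ j ])
               (λ (y≋ , α≋) j → +-cong (·-cong a y≋ j) (·-cong w α≋ j))
               (≡.subst (ℕ._< q ℕ.^ suc n) (ℕₚ.^-distribˡ-+-* q d m)
                 (ℕₚ.^-monoʳ-< q 1<q (ℕₚ.≤-trans (ℕₚ.≤-reflexive (≡.sym (ℕₚ.+-suc d m))) d+m≤n)))
        with l , x , y , x∈ , eq ← covering v =
        linComb F x u ∷ᵥ w , (λ { zero → x , x∈ , (λ _ → refl) ; (suc i) → w∈U i }) , independent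
        where
        independent : ∀ (y : Tuple d) (α : Tuple (suc m)) →
          (∀ j → y · a [ j ] + α · (linComb F x u ∷ᵥ w) [ j ] ≈ 0#) → ∀ i → α i ≈ 0#
        independent y′ α eq′ with α zero ≟ 0#
        ... | yes α₀≈0 = λ { zero → α₀≈0 ; (suc i) → w-independent y′ (α ∘ suc) (λ j → begin
              y′ · a [ j ] + (α ∘ suc) · w [ j ]
                ≈⟨ solve 3 (λ y x w → y :+ w := y :+ (con (+ 0) :* x :+ w)) refl _ (x · u [ j ]) _ ⟩
              y′ · a [ j ] + (0# * x · u [ j ] + (α ∘ suc) · w [ j ])
                ≈⟨ +-congˡ (+-congʳ (*-congʳ α₀≈0)) ⟨
              y′ · a [ j ] + α · (linComb F x u ∷ᵥ w) [ j ]
                ≈⟨ eq′ j ⟩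
              0# ∎) i }
        ... | no  α₀≉0 with b , α₀b≈1 ← inverse (α zero) α₀≉0 =
          ⊥-elim (missed ((λ i → y i - (l * b) * y′ i) , (- (l * b)) ⊠ (α ∘ suc)) λ j → begin
            (λ i → y i - (l * b) * y′ i) · a [ j ] + ((- (l * b)) ⊠ (α ∘ suc)) · w [ j ]
              ≈⟨ +-cong (trans (·-- y ((l * b) ⊠ y′) a j) (+-congˡ (-‿cong (·-* (l * b) y′ a j))))
                        (·-* (- (l * b)) (α ∘ suc) w j) ⟩
            y · a [ j ] - l * b * y′ · a [ j ] + - (l * b) * (α ∘ suc) · w [ j ]
              ≈⟨ solve 7 (λ y l b y′ w α x → y :- l :* b :* y′ :+ :- (l :* b) :* w :=
                   l :* (α :* b) :* x :+ y :- l :* b :* (y′ :+ (α :* x :+ w))) refl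
                   (y · a [ j ]) l b (y′ · a [ j ]) ((α ∘ suc) · w [ j ]) (α zero) (x · u [ j ]) ⟩
            l * (α zero * b) * x · u [ j ] + y · a [ j ] - l * b * (y′ · a [ j ] + α · (linComb F x u ∷ᵥ w) [ j ])
              ≈⟨ +-cong (+-congʳ (*-congʳ (trans (*-congˡ α₀b≈1) (*-identityʳ l))))
                        (-‿cong (trans (*-congˡ (eq′ j)) (zeroʳ _))) ⟩
            l * x · u [ j ] + y · a [ j ] - 0#
              ≈⟨ solve 1 (λ z → z :- con (+ 0) := z) refl _ ⟩
            l * x · u [ j ] + y · a [ j ]
              ≈⟨ eq j ⟨
            v j ∎)

-- Cardinalities: F × U × A against V.

open import Data.Nat using (_*_; _^_; _≤_; _<_)

triples-size : ∀ p h D d → p ^ h * (p ^ D * (p ^ h) ^ d) ≡ p ^ (h ℕ.+ (D ℕ.+ h * d))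
triples-size p h D d = begin
  p ^ h * (p ^ D * (p ^ h) ^ d)      ≡⟨ ≡.cong (λ x → p ^ h * (p ^ D * x)) (ℕₚ.^-*-assoc p h d) ⟩
  p ^ h * (p ^ D * p ^ (h * d))      ≡⟨ ≡.cong (p ^ h *_) (ℕₚ.^-distribˡ-+-* p D (h * d)) ⟨
  p ^ h * p ^ (D ℕ.+ h * d)          ≡⟨ ℕₚ.^-distribˡ-+-* p h _ ⟨
  p ^ (h ℕ.+ (D ℕ.+ h * d))          ∎
  where open ≡.≡-Reasoning

-- U has 𝔽ₚ-dimension h k + 1. When d + k = n, the total exceeds the 𝔽ₚ-dimension h (n + 1) of V by
-- exactly 1, the source of the surplus factor p.
exponent : ∀ h k d → h ℕ.+ (suc (h * k) ℕ.+ h * d) ≡ suc (h * suc (d ℕ.+ k))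
exponent = solve 3 (λ h k d → h :+ (con 1 :+ h :* k :+ h :* d) := con 1 :+ h :* (con 1 :+ (d :+ k))) ≡.refl
  where open +-*-Solver

-- With A at least one dimension short of n - k, the exponent is at most 1 + h n; it stays below h +
-- h n precisely because h > 1.
triples-small : ∀ {p h n k d} → 1 < p → 1 < h → suc d ℕ.+ k ≤ n →
                p ^ h * (p ^ suc (h * k) * (p ^ h) ^ d) < (p ^ h) ^ suc n
triples-small {p} {h} {n} {k} {d} 1<p 1<h d+k<n =
  ≡.subst₂ _<_ (≡.sym (triples-size p h _ d)) (≡.sym (ℕₚ.^-*-assoc p h (suc n)))
    (ℕₚ.^-monoʳ-< p 1<p (begin-strict
      h ℕ.+ (suc (h * k) ℕ.+ h * d)    ≡⟨ exponent h k d ⟩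
      1 ℕ.+ h * suc (d ℕ.+ k)          ≤⟨ ℕ.s≤s (ℕₚ.*-monoʳ-≤ h d+k<n) ⟩
      1 ℕ.+ h * n                      <⟨ ℕₚ.+-monoˡ-< (h * n) 1<h ⟩
      h ℕ.+ h * n                      ≡⟨ ℕₚ.*-suc h n ⟨
      h * suc n                        ∎))
  where open ℕₚ.≤-Reasoning

triples-exact : ∀ p h {n k d} → d ℕ.+ k ≡ n →
                p ^ h * (p ^ suc (h * k) * (p ^ h) ^ d) ≡ (p ^ h) ^ suc n * p
triples-exact p h {n} {k} {d} d+k≡n = begin
  p ^ h * (p ^ suc (h * k) * (p ^ h) ^ d)    ≡⟨ triples-size p h (suc (h * k)) d ⟩
  p ^ (h ℕ.+ (suc (h * k) ℕ.+ h * d))        ≡⟨ ≡.cong (p ^_) (exponent h k d) ⟩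
  p * p ^ (h * suc (d ℕ.+ k))                ≡⟨ ≡.cong (λ m → p * p ^ (h * suc m)) d+k≡n ⟩
  p * p ^ (h * suc n)                        ≡⟨ ≡.cong (p *_) (ℕₚ.^-*-assoc p h (suc n)) ⟨
  p * (p ^ h) ^ suc n                        ≡⟨ ℕₚ.*-comm p _ ⟩
  (p ^ h) ^ suc n * p                        ∎
  where open ≡.≡-Reasoning

-- From an F-linear first moment to a k-space inside B(U).

module MainProof (F : CommutativeRing 0ℓ 0ℓ) (isField : IsField F)
  (p h : ℕ) (p-prime : Prime p) (hasSize : HasSize F (p ^ h)) where
  open CommutativeRing F hiding (zero; _*_)
  open CommutativeRing F using () renaming (_*_ to _·ᶠ_)
  open IsField isField
  open FieldProperties F isField
  open FiniteFieldProperties F isField p h p-prime hasSize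
  open VectorSums F isField p h p-prime hasSize
  open CodewordMoments F isField p h p-prime hasSize
  open LinearSets F isField p h p-prime hasSize
  open IntegerSolver F
  open SetoidReasoning setoid

  1<p : 1 < p
  1<p = ℕ.nonTrivial⇒n>1 p {{prime⇒nonTrivial p-prime}}

  𝔽ₚ-independent : ∀ {D n} (U : FpSubspace F p D n) (x : Tuple (suc D)) → 𝔽ₚ-Tuple x →
    (∀ j → x · FpSubspace.basis U [ j ] ≈ 0#) → ∀ i → x i ≈ 0#
  𝔽ₚ-independent U x x∈ eq i = trans (embed-coordinates x∈ i) (reflexive (≡.cong ι
    (FpSubspace.independent U (coordinates x∈) (λ j → trans (fpComb≈· (coordinates x∈) (FpSubspace.basis U) j)
      (trans (sym (·-cong (FpSubspace.basis U) (embed-coordinates x∈) j)) (eq j))) i)))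

  module PrimeField (h≡1 : h ≡ 1) where

    all-𝔽ₚ : ∀ x → 𝔽ₚ x
    all-𝔽ₚ x with i , i≈x ← injective⇒surjective (Fin-finite p) F-finite
      (ℕₚ.≤-reflexive (≡.trans (≡.cong (p ^_) h≡1) (ℕₚ.^-identityʳ p)))
      (ι ∘ toℕ) (λ i≡j → reflexive (≡.cong (ι ∘ toℕ) i≡j)) (λ i j → ι-injective) x = i , sym i≈x

    contains-subspace : ∀ {D k n} → D ≡ k → (U : FpSubspace F p D n) → ContainsSubspace F k n U
    contains-subspace ≡.refl U = record
      { basis = FpSubspace.basis U
      ; independent = λ a eq → 𝔽ₚ-independent U a (λ i → all-𝔽ₚ (a i)) eq
      } , λ x x≉0 (a , eq) → 1# , 1≉0 , (λ i → proj₁ (all-𝔽ₚ (a i))) , λ j → begin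
        1# ·ᶠ x j                                                          ≈⟨ *-identityˡ _ ⟩
        x j                                                                ≈⟨ eq j ⟩
        a · FpSubspace.basis U [ j ]                                       ≈⟨ ·-cong (FpSubspace.basis U) (λ i → proj₂ (all-𝔽ₚ (a i))) j ⟩
        embed (λ i → proj₁ (all-𝔽ₚ (a i))) · FpSubspace.basis U [ j ]      ≈⟨ fpComb≈· (λ i → proj₁ (all-𝔽ₚ (a i))) (FpSubspace.basis U) j ⟨
        fpComb F p (λ i → proj₁ (all-𝔽ₚ (a i))) (FpSubspace.basis U) j     ∎

  p<q : 1 < h → p < q
  p<q 1<h = ≡.subst (_< q) (ℕₚ.^-identityʳ p) (ℕₚ.^-monoʳ-< p 1<p 1<h)

  -- Such a μ differs from 0 and 1, as the vanishing of ∑ c over F requires.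
  ∃-nonprime : 1 < h → ∃ λ μ → ¬ 𝔽ₚ μ
  ∃-nonprime 1<h with μ , missed ← unhit (Fin-finite p) F-finite (ι ∘ toℕ)
    (λ i≡j → reflexive (≡.cong (ι ∘ toℕ) i≡j)) (p<q 1<h) = μ , λ (i , μ≈i) → missed i (sym μ≈i)

  module ProperExtension (1<h : 1 < h) {n k d : ℕ} (d+k≡n : d ℕ.+ k ≡ n)
    (U : FpSubspace F p (h * k) n) (f : Vector F n → ℕ) (isInc : IsIncidenceVector F n (InB F U) f)
    (a : Fin d → Vector F n) (skew : Skew (FpSubspace.basis U) a)
    {μ} (μ≉0 : ¬ (μ ≈ 0#)) (μ≉1 : ¬ (μ ≈ 1#)) (M : Moments μ≉0 μ≉1 a (ι ∘ f)) where

    open FpSubspace U renaming (basis to u)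
    open Complement u a skew (triples-exact p h d+k≡n)
    open Moments M

    D : ℕ
    D = suc (h * k)

    module _ {x : Tuple D} (x∈ : 𝔽ₚ-Tuple x) (x≉0 : ¬ (∀ i → x i ≈ 0#)) (tangent : Tangent x) where

      shifted : Tuple d → Vector F n
      shifted y = linComb F x u ⊞ linComb F y a

      shifted≉0 : ∀ y → NonZeroV F (shifted y)
      shifted≉0 y eq = x≉0 (proj₂ (skew y x x∈ (λ j → trans (+-comm _ _) (eq j))))

      f-at-0 : ∀ y → (∀ i → y i ≈ 0#) → ι (f (shifted y)) ≈ 1#
      f-at-0 y y≈0 = trans (reflexive (≡.cong ι (proj₁ (isInc (shifted y) (shifted≉0 y))
        (1# , 1≉0 , coordinates x∈ , λ j → begin
          1# ·ᶠ (x · u [ j ] + y · a [ j ])      ≈⟨ *-identityˡ _ ⟩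
          x · u [ j ] + y · a [ j ]              ≈⟨ +-congˡ (·-0 a y≈0 j) ⟩
          x · u [ j ] + 0#                       ≈⟨ +-identityʳ _ ⟩
          x · u [ j ]                            ≈⟨ ·-cong u (embed-coordinates x∈) j ⟩
          embed (coordinates x∈) · u [ j ]       ≈⟨ fpComb≈· (coordinates x∈) u j ⟨
          fpComb F p (coordinates x∈) u j        ∎)))) (+-identityʳ 1#)

      -- Suppose l (x · u + y · a) lies in U. Tangency puts l in 𝔽ₚ, so l x · u is itself in U, and
      -- skewness splits the relation into its U-part and its A-part, giving l y = 0.
      f-off-0 : ∀ y → ¬ (∀ i → y i ≈ 0#) → ι (f (shifted y)) ≈ 0#
      f-off-0 y y≉0 = reflexive (≡.cong ι (proj₂ (isInc (shifted y) (shifted≉0 y))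
        λ (l , l≉0 , c , eq) → y≉0 λ i → no-zero-divisor l≉0 (on-line l c eq i)))
        where
        on-line : ∀ l c → (∀ j → l ·ᶠ shifted y j ≈ fpComb F p c u j) → ∀ i → l ·ᶠ y i ≈ 0#
        on-line l c eq = proj₁ (skew (l ⊠ y) (λ i → l ·ᶠ x i - embed c i)
          (λ i → 𝔽ₚ-- (𝔽ₚ-* l∈ (x∈ i)) (embed-∈ c i)) λ j → begin
            (l ⊠ y) · a [ j ] + (λ i → l ·ᶠ x i - embed c i) · u [ j ]
              ≈⟨ +-cong (·-* l y a j) (trans (·-- (l ⊠ x) (embed c) u j) (+-congʳ (·-* l x u j))) ⟩
            l ·ᶠ y · a [ j ] + (l ·ᶠ x · u [ j ] - embed c · u [ j ])
              ≈⟨ solve 4 (λ l y x c → l :* y :+ (l :* x :- c) := l :* (x :+ y) :- c) refl l _ _ _ ⟩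
            l ·ᶠ shifted y j - embed c · u [ j ]
              ≈⟨ x≈y⇒x-y≈0 (trans (eq j) (fpComb≈· c u j)) ⟩
            0# ∎)
          where
          l∈ : 𝔽ₚ l
          l∈ = tangent l (embed c) ((- l) ⊠ y) (embed-∈ c) λ j → begin
            l ·ᶠ x · u [ j ]
              ≈⟨ solve 3 (λ l x y → l :* x := l :* (x :+ y) :+ :- l :* y) refl l _ (y · a [ j ]) ⟩
            l ·ᶠ shifted y j + - l ·ᶠ y · a [ j ]
              ≈⟨ +-cong (trans (eq j) (fpComb≈· c u j)) (sym (·-* (- l) y a j)) ⟩
            embed c · u [ j ] + ((- l) ⊠ y) · a [ j ] ∎

      f-congruent : Congruent (λ y → ι (f (shifted y)))
      f-congruent {y} {y′} y≋y′ with y ≋? (λ _ → 0#)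
      ... | yes y≈0 = trans (f-at-0 y y≈0) (sym (f-at-0 y′ (λ i → trans (sym (y≋y′ i)) (y≈0 i))))
      ... | no  y≉0 = trans (f-off-0 y y≉0) (sym (f-off-0 y′ λ y′≈0 → y≉0 λ i → trans (y≋y′ i) (y′≈0 i)))

      tangent⇒mass≈1 : mass ≈ 1#
      tangent⇒mass≈1 = trans (sym (zeroth (linComb F x u) shifted≉0))
        (trans (∑ᵛ-point d f-congruent (λ _ → 0#) f-off-0) (f-at-0 (λ _ → 0#) (λ _ → refl)))

      -- Only y = 0 contributes to the first moment, and it does so with weight y i = 0.
      tangent⇒ℓ≈0 : ∀ i → ℓ (linComb F x u) i ≈ 0#
      tangent⇒ℓ≈0 i = trans (sym (first (linComb F x u) shifted≉0 i))
        (trans (∑ᵛ-point d (λ y≋ → *-cong (y≋ i) (f-congruent y≋)) (λ _ → 0#)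
                 (λ y y≉0 → trans (*-congˡ (f-off-0 y y≉0)) (zeroʳ _)))
               (zeroˡ _))

    -- One nonzero tangent vector suffices; the first coordinate, which is 1 at the all-ones tuple,
    -- yields it through `tangent-exists`.
    mass≈1 : mass ≈ 1#
    mass≈1 with x , x∈ , x₀≉0 , tangent ← tangent-exists (λ x → x zero) (λ eq → eq zero) (λ _ _ _ → refl)
                  (λ _ → 1#) (λ _ → 𝔽ₚ-1) 1≉0
      = tangent⇒mass≈1 x∈ (λ x≈0 → x₀≉0 (x≈0 zero)) tangent

    ℓ-0 : ∀ {v} → (∀ j → v j ≈ 0#) → ∀ i → ℓ v i ≈ 0#
    ℓ-0 {v} v≈0 i = begin
      ℓ v i                ≈⟨ ℓ-cong (λ j → trans (v≈0 j) (sym (zeroˡ (v j)))) i ⟩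
      ℓ (0# ⊠ v) i         ≈⟨ ℓ-⊠ 0# v i ⟩
      0# ·ᶠ ℓ v i          ≈⟨ zeroˡ _ ⟩
      0#                   ∎

    ℓ-U : ∀ x → 𝔽ₚ-Tuple x → ∀ i → ℓ (linComb F x u) i ≈ 0#
    ℓ-U x x∈ i = decidable-stable (ℓ (linComb F x u) i ≟ 0#) λ ℓ≉0 →
      let x′ , x′∈ , ℓ≉0′ , tangent = tangent-exists (λ x → ℓ (linComb F x u) i)
            (λ eq → ℓ-cong (·-cong u eq) i) linear x x∈ ℓ≉0
      in ℓ≉0′ (tangent⇒ℓ≈0 x′∈ (λ x′≈0 → ℓ≉0′ (ℓ-0 (·-0 u x′≈0) i)) tangent i)
      where
      linear : ∀ c x x′ → ℓ (linComb F (c ⊠ x ⊞ x′) u) i ≈ c ·ᶠ ℓ (linComb F x u) i + ℓ (linComb F x′ u) i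
      linear c x x′ = begin
        ℓ (linComb F (c ⊠ x ⊞ x′) u) i
          ≈⟨ ℓ-cong (λ j → trans (·-+ (c ⊠ x) x′ u j) (+-congʳ (·-* c x u j))) i ⟩
        ℓ (c ⊠ linComb F x u ⊞ linComb F x′ u) i
          ≈⟨ ℓ-⊞ (c ⊠ linComb F x u) (linComb F x′ u) i ⟩
        ℓ (c ⊠ linComb F x u) i + ℓ (linComb F x′ u) i
          ≈⟨ +-congʳ (ℓ-⊠ c (linComb F x u) i) ⟩
        c ·ᶠ ℓ (linComb F x u) i + ℓ (linComb F x′ u) i ∎

    ℓ-combination : ∀ {m} (α : Tuple m) (w : Fin m → Vector F n) → (∀ i → ∀ j → ℓ (w i) j ≈ 0#) →
                    ∀ i → ℓ (linComb F α w) i ≈ 0#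
    ℓ-combination {zero}  α w ℓw≈0 i = ℓ-0 (λ _ → refl) i
    ℓ-combination {suc m} α w ℓw≈0 i = begin
      ℓ (α zero ⊠ w zero ⊞ linComb F (α ∘ suc) (w ∘ suc)) i
        ≈⟨ ℓ-⊞ (α zero ⊠ w zero) (linComb F (α ∘ suc) (w ∘ suc)) i ⟩
      ℓ (α zero ⊠ w zero) i + ℓ (linComb F (α ∘ suc) (w ∘ suc)) i
        ≈⟨ +-cong (trans (ℓ-⊠ (α zero) (w zero) i) (trans (*-congˡ (ℓw≈0 zero i)) (zeroʳ _)))
                  (ℓ-combination (α ∘ suc) (w ∘ suc) (ℓw≈0 ∘ suc) i) ⟩
      0# + 0#
        ≈⟨ +-identityˡ 0# ⟩
      0# ∎

    -- Write v = l u + y by `covering`. As ℓ vanishes on U and the mass is 1, ℓ v = -y, so y = 0 and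
    -- v is a multiple of u; l is nonzero since v is.
    ℓ≈0⇒InB : ∀ v → NonZeroV F v → (∀ i → ℓ v i ≈ 0#) → InB F U v
    ℓ≈0⇒InB v v≉0 ℓv≈0 with l , x , y , x∈ , eq ← covering v = on-multiple (l ≟ 0#)
      where
      y≈0 : ∀ i → y i ≈ 0#
      y≈0 i = begin
        y i
          ≈⟨ solve 1 (λ y → y := con (+ 0) :- (:- (con (+ 1) :* y))) refl (y i) ⟩
        0# - - (1# ·ᶠ y i)
          ≈⟨ +-congˡ (-‿cong (trans (-‿cong (*-congʳ (sym mass≈1))) (sym (ℓ-a y i)))) ⟩
        0# - ℓ (linComb F y a) i
          ≈⟨ +-congʳ (trans (sym (ℓv≈0 i)) (trans (ℓ-cong eq i) (trans (ℓ-⊞ (l ⊠ linComb F x u) (linComb F y a) i)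
               (+-congʳ (ℓ-⊠ l (linComb F x u) i))))) ⟩
        l ·ᶠ ℓ (linComb F x u) i + ℓ (linComb F y a) i - ℓ (linComb F y a) i
          ≈⟨ +-congʳ (+-congʳ (trans (*-congˡ (ℓ-U x x∈ i)) (zeroʳ l))) ⟩
        0# + ℓ (linComb F y a) i - ℓ (linComb F y a) i
          ≈⟨ solve 1 (λ z → con (+ 0) :+ z :- z := con (+ 0)) refl (ℓ (linComb F y a) i) ⟩
        0# ∎
      v≈lx : ∀ j → v j ≈ l ·ᶠ x · u [ j ]
      v≈lx j = trans (eq j) (trans (+-congˡ (·-0 a y≈0 j)) (+-identityʳ _))
      on-multiple : Dec (l ≈ 0#) → InB F U v
      on-multiple (yes l≈0) = ⊥-elim (v≉0 λ j → trans (v≈lx j) (trans (*-congʳ l≈0) (zeroˡ _)))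
      on-multiple (no  l≉0) with b , lb≈1 ← inverse l l≉0 =
        b , unit≉0 (trans (*-comm b l) lb≈1) , coordinates x∈ , λ j → begin
          b ·ᶠ v j                               ≈⟨ *-congˡ (v≈lx j) ⟩
          b ·ᶠ (l ·ᶠ x · u [ j ])                ≈⟨ solve 3 (λ b l x → b :* (l :* x) := l :* b :* x) refl b l (x · u [ j ]) ⟩
          l ·ᶠ b ·ᶠ x · u [ j ]                  ≈⟨ trans (*-congʳ lb≈1) (*-identityˡ _) ⟩
          x · u [ j ]                            ≈⟨ ·-cong u (embed-coordinates x∈) j ⟩
          embed (coordinates x∈) · u [ j ]       ≈⟨ fpComb≈· (coordinates x∈) u j ⟨
          fpComb F p (coordinates x∈) u j        ∎

    -- The k-space is spanned over F by k + 1 vectors of U independent modulo A. Since ℓ is F-linear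
    -- and vanishes on them, it vanishes on their whole span.
    contains-subspace : ContainsSubspace F k n U
    contains-subspace with w , w∈U , w-independent ← spanning-family (ℕₚ.<-trans 1<p (p<q 1<h)) (suc k)
      (ℕₚ.≤-reflexive (≡.trans (ℕₚ.+-suc d k) (≡.cong suc d+k≡n))) = S , λ v v≉0 (α , v≋αw) →
        ℓ≈0⇒InB v v≉0 λ i → trans (ℓ-cong v≋αw i) (ℓ-combination α w ℓw≈0 i)
      where
      S : Subspace F k n
      S = record { basis = w ; independent = λ α eq → w-independent (λ _ → 0#) α λ j →
        trans (+-congʳ (·-0 a (λ _ → refl) j)) (trans (+-identityˡ _) (eq j)) }
      ℓw≈0 : ∀ i j → ℓ (w i) j ≈ 0#
      ℓw≈0 i j with x , x∈ , w≋xu ← w∈U i = trans (ℓ-cong w≋xu j) (ℓ-U x x∈ j)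

theorem3p20 : (p h n k : ℕ) → Prime p → 1 ≤ h → n ≤ 2 * k → k < n →
    (F : CommutativeRing 0ℓ 0ℓ) → IsField F → HasSize F (p ^ h) →
    (U : FpSubspace F p (h * k) n) →
    ¬ ContainsSubspace F k n U →
    (v : Vector F n → ℕ) → IsIncidenceVector F n (InB F U) v →
    ¬ InCode F p k n v
theorem3p20 p h n k p-prime 1≤h _ k<n F isField hasSize U nontrivial v isInc v∈C with ℕₚ.m≤n⇒m<n∨m≡n 1≤h
... | inj₂ 1≡h = nontrivial (PrimeField.contains-subspace (≡.sym 1≡h)
        (≡.trans (≡.cong (_* k) (≡.sym 1≡h)) (ℕₚ.*-identityˡ k)) U)
  where open MainProof F isField p h p-prime hasSize
... | inj₁ 1<h
  with μ , μ∉𝔽ₚ ← MainProof.∃-nonprime F isField p h p-prime hasSize 1<h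
  with a , skew ← LinearSets.skew-exists F isField p h p-prime hasSize (FpSubspace.basis U)
         (MainProof.𝔽ₚ-independent F isField p h p-prime hasSize U) (n ℕ.∸ k)
         (λ d′ d′<d → triples-small (MainProof.1<p F isField p h p-prime hasSize) 1<h
           (ℕₚ.≤-trans (ℕₚ.+-monoˡ-≤ k d′<d) (ℕₚ.≤-reflexive (ℕₚ.m∸n+n≡m (ℕₚ.<⇒≤ k<n))))) =
  nontrivial (ProperExtension.contains-subspace 1<h d+k≡n U v isInc a skew μ≉0 μ≉1
    (Moments-code μ≉0 μ≉1 a d+k≡n v∈C))
  where
  open CommutativeRing F using (_≈_; 0#; 1#; sym)
  open MainProof F isField p h p-prime hasSize
  open FiniteFieldProperties F isField p h p-prime hasSize using (𝔽ₚ-resp; 𝔽ₚ-0; 𝔽ₚ-1)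
  open CodewordMoments F isField p h p-prime hasSize using (Moments-code)
  d+k≡n : (n ℕ.∸ k) ℕ.+ k ≡ n
  d+k≡n = ℕₚ.m∸n+n≡m (ℕₚ.<⇒≤ k<n)
  μ≉0 : ¬ (μ ≈ 0#)
  μ≉0 μ≈0 = μ∉𝔽ₚ (𝔽ₚ-resp (sym μ≈0) 𝔽ₚ-0)
  μ≉1 : ¬ (μ ≈ 1#)
  μ≉1 μ≈1 = μ∉𝔽ₚ (𝔽ₚ-resp (sym μ≈1) 𝔽ₚ-1)
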